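{- Let $G$ be a hypergraph on $[n]$ and $P_G=\sum_{U\in G}\Delta_U$ its hypergraphic polytope. Then $P_G$ is a simple polytope if and only if for every $\mathcal O\in\mathfrak O_0(G)$ the Hasse diagram $\mathrm{Hasse}(G/\mathcal O)$ is a forest.
   Context: A hypergraph on $[n]$ is a set $G$ of subsets of $[n]$ each of size at least $2$. $\Delta_U=\mathrm{conv}\{e_i: i\in U\}\subset\mathbb R^n$ and the sum is Minkowski sum. An orientation $\mathcal O$ of $G$ chooses for each $U\in G$ an ordered pair $(\mathfrak a_U,\mathfrak b_U)$ of nonempty disjoint sets with union $U$ (head $\mathfrak a_U$). $V/\mathcal O$ is the partition of $[n]$ generated by the transitive closure of $a\sim a'$ whenever $a,a'$ lie in a common head; $G/\mathcal O$ is the directed multigraph on $V/\mathcal O$ with, for each $U$ and each $b\in\mathfrak b_U$, an arrow from the class of $\mathfrak a_U$ to the class of $b$ (loops allowed). $\mathcal O$ is acyclic if $G/\mathcal O$ has no directed cycle (loops count). $\mathfrak O_0(G)$ is the set of acyclic orientations $\mathcal O$ of $G$ with $|V/\mathcal O|=n$, i.e. all heads are singletons, so $G/\mathcal O$ is a directed acyclic graph on $[n]$. $\mathrm{Hasse}(G/\mathcal O)$ is the Hasse diagram (transitive reduction) of the partial order on $[n]$ in which $u\le v$ iff there is a directed path from $u$ to $v$ in $G/\mathcal O$; it is a forest if its underlying undirected graph has no cycle. A $d$-dimensional polytope is simple if each vertex lies on exactly $d$ edges.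
   Formalization: The polytope P_G, its faces, dimension and linear functionals are taken over the rationals (in Q^n) instead of R^n; since P_G is a lattice polytope, its vertices, edges and dimension are the same. -}

module Defs where

open import Data.Nat using (ℕ; zero; suc) renaming (_≤_ to _≤ℕ_)
open import Data.Fin using (Fin; zero; suc; inject₁; fromℕ)
open import Data.Fin.Subset using (Subset; _∈_; _∉_; ∣_∣)
open import Data.List using (List; length; lookup)
open import Data.List.Relation.Unary.All using (All)
open import Data.List.Relation.Unary.Unique.Propositional using (Unique)
open import Data.Rational using (ℚ; 0ℚ; 1ℚ; _+_; _*_; _≤_)
open import Data.Product using (Σ; ∃; _×_; _,_)
open import Data.Sum using (_⊎_)
open import Relation.Nullary using (¬_)
open import Data.Empty using (⊥)
open import Relation.Binary.PropositionalEquality using (_≡_)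
open import Relation.Binary.Construct.Closure.Transitive using (TransClosure)
open import Function.Definitions using (Injective)

Σᶠ : (k : ℕ) → (Fin k → ℚ) → ℚ
Σᶠ zero    f = 0ℚ
Σᶠ (suc k) f = f zero + Σᶠ k (λ i → f (suc i))

-- Points of ℚ^n (rational points of ℝ^n)
Point : ℕ → Set
Point n = Fin n → ℚ

_≈ₚ_ : {n : ℕ} → Point n → Point n → Set
x ≈ₚ y = ∀ i → x i ≡ y i

_·_ : {n : ℕ} → Point n → Point n → ℚ
_·_ {n} c x = Σᶠ n (λ i → c i * x i)

IsHypergraph : (n : ℕ) → List (Subset n) → Set
IsHypergraph n G = Unique G × All (λ U → 2 ≤ℕ ∣ U ∣) G

-- Δ_U = conv{e_i : i ∈ U}
InΔ : {n : ℕ} → Subset n → Point n → Set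
InΔ {n} U y = (∀ i → 0ℚ ≤ y i) × (∀ i → i ∉ U → y i ≡ 0ℚ) × (Σᶠ n y ≡ 1ℚ)

InP : {n : ℕ} → List (Subset n) → Point n → Set
InP {n} G x =
  Σ (Fin (length G) → Point n) λ ys →
    (∀ j → InΔ (lookup G j) (ys j)) × (∀ i → x i ≡ Σᶠ (length G) (λ j → ys j i))

Face : {n : ℕ} → List (Subset n) → Point n → Point n → Set
Face G c x = InP G x × (∀ y → InP G y → (c · y) ≤ (c · x))

AffInd : {n k : ℕ} → (Fin (suc k) → Point n) → Set
AffInd {n} {k} p =
  (λs : Fin (suc k) → ℚ) → Σᶠ (suc k) λs ≡ 0ℚ →
  (∀ i → Σᶠ (suc k) (λ j → λs j * p j i) ≡ 0ℚ) → ∀ j → λs j ≡ 0ℚ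

HasDim : {n : ℕ} → (Point n → Set) → ℕ → Set
HasDim {n} S k =
  (Σ (Fin (suc k) → Point n) λ p → (∀ j → S (p j)) × AffInd p) ×
  ¬ (Σ (Fin (suc (suc k)) → Point n) λ p → (∀ j → S (p j)) × AffInd p)

Vertex : {n : ℕ} → List (Subset n) → Point n → Set
Vertex {n} G x = Σ (Point n) λ c → Face G c x × (∀ y → Face G c y → y ≈ₚ x)

Adjacent : {n : ℕ} → List (Subset n) → Point n → Point n → Set
Adjacent {n} G v w =
  Vertex G v × Vertex G w × ¬ (v ≈ₚ w) ×
  Σ (Point n) λ c → HasDim (Face G c) 1 × Face G c v × Face G c w

-- vertex v lies on exactly d edges (= has exactly d neighbours)
DegreeIs : {n : ℕ} → List (Subset n) → Point n → ℕ → Set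
DegreeIs {n} G v d =
  Σ (Fin d → Point n) λ ws →
    (∀ j → Adjacent G v (ws j)) ×
    (∀ j j′ → ws j ≈ₚ ws j′ → j ≡ j′) ×
    (∀ w → Adjacent G v w → ∃ λ j → w ≈ₚ ws j)

IsSimple : {n : ℕ} → List (Subset n) → Set
IsSimple {n} G = ∀ d → HasDim (InP G) d → ∀ v → Vertex G v → DegreeIs G v d

-- Orientations with singleton heads: h j is the head of the j-th hyperedge
-- Arrow h u v: an arrow u → v of G/O
Arrow : {n : ℕ} (G : List (Subset n)) → (Fin (length G) → Fin n) → Fin n → Fin n → Set
Arrow G h u v = ∃ λ j → h j ≡ u × v ∈ lookup G j × ¬ (v ≡ u)

Path : {n : ℕ} (G : List (Subset n)) → (Fin (length G) → Fin n) → Fin n → Fin n → Set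
Path G h = TransClosure (Arrow G h)

InO₀ : {n : ℕ} (G : List (Subset n)) → (Fin (length G) → Fin n) → Set
InO₀ {n} G h = (∀ j → h j ∈ lookup G j) × (∀ (u : Fin n) → ¬ Path G h u u)

Cover : {n : ℕ} (G : List (Subset n)) → (Fin (length G) → Fin n) → Fin n → Fin n → Set
Cover G h u v = Path G h u v × ¬ (∃ λ w → Path G h u w × Path G h w v)

HasseAdj : {n : ℕ} (G : List (Subset n)) → (Fin (length G) → Fin n) → Fin n → Fin n → Set
HasseAdj G h u v = Cover G h u v ⊎ Cover G h v u

IsForest : {n : ℕ} (G : List (Subset n)) → (Fin (length G) → Fin n) → Set
IsForest {n} G h =
  ∀ (k : ℕ) (c : Fin (suc (suc (suc k))) → Fin n) → Injective _≡_ _≡_ c →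
    (∀ (i : Fin (suc (suc k))) → HasseAdj G h (c (inject₁ i)) (c (suc i))) →
    HasseAdj G h (c (fromℕ (suc (suc k)))) (c zero) → ⊥

{-# OPTIONS --safe #-}

-- The vertices of P_G are the points X h = Σ_U e_{h(U)} for h ∈ 𝔒₀(G): a functional exposes a vertex exactly
-- when it has a unique maximum on every hyperedge, and it then decreases along the arrows of G/h.
-- The cone of P_G at X h is generated by the vectors e_v − e_u with u < v in the order of G/h, hence by those of the
-- covers u ⋖ v, and each cover contributes exactly one edge, which leads to the vertex X h′ where h′ replaces the
-- head u by v wherever possible. So X h has as many neighbours as Hasse(G/h) has edges, while dim P_G is the
-- rank of the vectors e_v − e_u over these edges; the two numbers agree iff those vectors are linearly
-- independent, that is, iff Hasse(G/h) is a forest.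
module Submission where

open import Defs
open import Data.Nat using (ℕ)
open import Data.Fin using (Fin)
open import Data.Fin.Subset using (Subset)
open import Data.List using (List; length)
open import Function.Bundles using (_⇔_)

open import Data.Bool using (true; false)
open import Data.Empty using (⊥; ⊥-elim)
open import Data.Fin using (zero; suc; inject₁; fromℕ; punchIn; punchOut)
import Data.Fin.Properties as Fin
open import Data.Fin.Subset using (_∈_; _∉_; ∣_∣; Nonempty)
open import Data.Fin.Subset.Properties using (_∈?_; nonempty?; Empty-unique; ∣⊥∣≡0)
open import Data.List using ([]; _∷_; lookup; filter; cartesianProduct; allFin)
open import Data.List.Membership.DecPropositional using () renaming (_∈?_ to _∈?ₗ_)
open import Data.List.Membership.Propositional using () renaming (_∈_ to _∈ₗ_)
open import Data.List.Membership.Propositional.Properties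
  using (∈-allFin; ∈-lookup; ∈-filter⁺; ∈-filter⁻; ∈-cartesianProduct⁺)
open import Data.List.Relation.Unary.All as All using ([])
open import Data.List.Relation.Unary.All.Properties using (¬Any⇒All¬)
open import Data.List.Relation.Unary.AllPairs using ([]; _∷_)
open import Data.List.Relation.Unary.Any using (here; there; index)
open import Data.List.Relation.Unary.Any.Properties using (lookup-index)
open import Data.List.Relation.Unary.Unique.Propositional using (Unique)
open import Data.List.Relation.Unary.Unique.Propositional.Properties using (cartesianProduct⁺; filter⁺; allFin⁺)
open import Data.Nat as ℕ using (zero; suc)
import Data.Nat.Properties as ℕ
open import Data.Product using (Σ; ∃; _×_; _,_; proj₁; proj₂)
open import Data.Rational
  using (ℚ; 0ℚ; 1ℚ; _+_; _*_; _-_; -_; 1/_; _≤_; _<_; NonZero; ≢-nonZero; nonNegative; positive)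
open import Data.Rational.Properties hiding (_≟_)
import Data.Rational.Properties as ℚ
open import Data.Sum using (_⊎_; inj₁; inj₂)
open import Data.Vec using ([]; _∷_; here; there)
open import Data.Vec.Functional using (insertAt) renaming (_∷_ to _◂_)
open import Data.Vec.Functional.Properties using (insertAt-lookup; insertAt-punchIn)
open import Function using (_∘_)
open import Function.Bundles using (mk⇔)
open import Function.Definitions using (Injective)
open import Relation.Binary.Construct.Closure.Transitive using (TransClosure; [_]; _∷_; _++_)
open import Relation.Binary.Definitions using (DecidableEquality; tri<; tri≈; tri>)
open import Relation.Binary.PropositionalEquality
open import Relation.Nullary using (¬_; ¬?; Dec; yes; no; _×-dec_; _⊎-dec_)
open import Relation.Nullary.Decidable using (dec⇒maybe; decidable-stable; map′)
open import Tactic.RingSolver using (solve-∀)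
open import Tactic.RingSolver.Core.AlmostCommutativeRing using (AlmostCommutativeRing; fromCommutativeRing)

-- The dimension is only compared, never computed: lower bounds are affinely independent points,
-- upper bounds are families spanning all displacements from `X h`. A cycle in the Hasse diagram
-- makes one cover direction redundant, so the polytope cannot have as many dimensions as there are
-- covers. In a forest, deleting an edge separates its ends, and the indicator of one side is a
-- functional isolating the coefficient of that edge. Facts about faces rest on one expansion: the
-- displacement of a point from `X h` is a sum of vectors `e a − e (h j)`, weighted by the
-- coordinates of its Minkowski summands. A functional maximal at `X h` forces the weights off its
-- ties to vanish on its face. For a cover the functional must tie the two ends and still drop along
-- every other path; counting up-sets of a suitable preorder achieves this with unit gaps.

private variable
  k m n : ℕ

ℚ-ring : AlmostCommutativeRing _ _
ℚ-ring = fromCommutativeRing +-*-commutativeRing (λ x → dec⇒maybe (0ℚ ℚ.≟ x))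

*-cancel-zero : ∀ {a b} → a ≢ 0ℚ → a * b ≡ 0ℚ → b ≡ 0ℚ
*-cancel-zero {a} {b} a≢0 ab≡0 = begin
  b                ≡⟨ *-identityˡ b ⟨
  1ℚ * b           ≡⟨ cong (_* b) (*-inverseˡ a) ⟨
  1/ a * a * b     ≡⟨ *-assoc (1/ a) a b ⟩
  1/ a * (a * b)   ≡⟨ cong (1/ a *_) ab≡0 ⟩
  1/ a * 0ℚ        ≡⟨ *-zeroʳ (1/ a) ⟩
  0ℚ               ∎
  where
  open ≡-Reasoning
  instance
    a-nonZero : NonZero a
    a-nonZero = ≢-nonZero a≢0

-- Finite sums

Σ-cong : {f g : Fin k → ℚ} → (∀ i → f i ≡ g i) → Σᶠ k f ≡ Σᶠ k g
Σ-cong {zero}  eq = refl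
Σ-cong {suc k} eq = cong₂ _+_ (eq zero) (Σ-cong (eq ∘ suc))

Σ-zero : ∀ k → Σᶠ k (λ _ → 0ℚ) ≡ 0ℚ
Σ-zero zero    = refl
Σ-zero (suc k) = trans (+-identityˡ _) (Σ-zero k)

Σ-+ : (f g : Fin k → ℚ) → Σᶠ k (λ i → f i + g i) ≡ Σᶠ k f + Σᶠ k g
Σ-+ {zero}  f g = refl
Σ-+ {suc k} f g = trans (cong (f zero + g zero +_) (Σ-+ (f ∘ suc) (g ∘ suc)))
                        (lemma (f zero) (g zero) _ _)
  where
  lemma : ∀ a b c d → (a + b) + (c + d) ≡ (a + c) + (b + d)
  lemma = solve-∀ ℚ-ring

Σ-*ˡ : ∀ a (f : Fin k → ℚ) → Σᶠ k (λ i → a * f i) ≡ a * Σᶠ k f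
Σ-*ˡ {zero}  a f = sym (*-zeroʳ a)
Σ-*ˡ {suc k} a f = trans (cong (a * f zero +_) (Σ-*ˡ a (f ∘ suc)))
                         (sym (*-distribˡ-+ a (f zero) _))

Σ-*ʳ : ∀ a (f : Fin k → ℚ) → Σᶠ k (λ i → f i * a) ≡ Σᶠ k f * a
Σ-*ʳ a f = trans (Σ-cong (λ i → *-comm (f i) a)) (trans (Σ-*ˡ a f) (*-comm a _))

Σ-swap : (f : Fin k → Fin m → ℚ) →
         Σᶠ k (λ i → Σᶠ m (f i)) ≡ Σᶠ m (λ j → Σᶠ k (λ i → f i j))
Σ-swap {zero}  {m} f = sym (Σ-zero m)
Σ-swap {suc k} {m} f = trans (cong (Σᶠ m (f zero) +_) (Σ-swap (f ∘ suc)))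
                             (sym (Σ-+ (f zero) _))

Σ-punchIn : ∀ (p : Fin (suc k)) (f : Fin (suc k) → ℚ) →
            Σᶠ (suc k) f ≡ f p + Σᶠ k (f ∘ punchIn p)
Σ-punchIn zero f = refl
Σ-punchIn {suc k} (suc p) f = trans (cong (f zero +_) (Σ-punchIn p (f ∘ suc)))
                                    (lemma (f zero) (f (suc p)) _)
  where
  lemma : ∀ a b c → a + (b + c) ≡ b + (a + c)
  lemma = solve-∀ ℚ-ring

Σ-mono-≤ : {f g : Fin k → ℚ} → (∀ i → f i ≤ g i) → Σᶠ k f ≤ Σᶠ k g
Σ-mono-≤ {zero}  le = ≤-refl
Σ-mono-≤ {suc k} le = +-mono-≤ (le zero) (Σ-mono-≤ (le ∘ suc))

-- The slack of a single term survives summation. With `δ` equal to 1 this is the unit gap of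
-- counting functions, with `f` zero the bound of one term by a nonnegative sum.
Σ-gap : ∀ {f g : Fin k → ℚ} {δ} → (∀ i → f i ≤ g i) →
        ∀ i → f i + δ ≤ g i → Σᶠ k f + δ ≤ Σᶠ k g
Σ-gap {suc k} {f} {g} {δ} le zero gap =
  subst (_≤ Σᶠ (suc k) g) (lemma (f zero) δ _) (+-mono-≤ gap (Σ-mono-≤ (le ∘ suc)))
  where
  lemma : ∀ a d s → (a + d) + s ≡ (a + s) + d
  lemma = solve-∀ ℚ-ring
Σ-gap {suc k} {f} {g} {δ} le (suc i) gap =
  subst (_≤ Σᶠ (suc k) g) (sym (+-assoc (f zero) _ δ)) (+-mono-≤ (le zero) (Σ-gap (le ∘ suc) i gap))

Σ-nonneg : {f : Fin k → ℚ} → (∀ i → 0ℚ ≤ f i) → 0ℚ ≤ Σᶠ k f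
Σ-nonneg {k} {f} nonneg = subst (_≤ Σᶠ k f) (Σ-zero k) (Σ-mono-≤ nonneg)

Σ-term-≤ : {f : Fin k → ℚ} → (∀ i → 0ℚ ≤ f i) → ∀ i → f i ≤ Σᶠ k f
Σ-term-≤ {k} {f} nonneg i =
  subst (_≤ Σᶠ k f) (trans (cong (_+ f i) (Σ-zero k)) (+-identityˡ (f i)))
    (Σ-gap nonneg i (≤-reflexive (+-identityˡ (f i))))

Σ-nonneg-zero : {f : Fin k → ℚ} → (∀ i → 0ℚ ≤ f i) → Σᶠ k f ≡ 0ℚ → ∀ i → f i ≡ 0ℚ
Σ-nonneg-zero nonneg Σ≡0 i = ≤-antisym (≤-trans (Σ-term-≤ nonneg i) (≤-reflexive Σ≡0)) (nonneg i)

-- Linear algebra over ℚ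

e : Fin n → Point n
e zero    zero    = 1ℚ
e zero    (suc i) = 0ℚ
e (suc a) zero    = 0ℚ
e (suc a) (suc i) = e a i

e-same : (a : Fin n) → e a a ≡ 1ℚ
e-same zero    = refl
e-same (suc a) = e-same a

e-diff : {a i : Fin n} → a ≢ i → e a i ≡ 0ℚ
e-diff {a = zero}  {zero}  a≢i = ⊥-elim (a≢i refl)
e-diff {a = zero}  {suc i} a≢i = refl
e-diff {a = suc a} {zero}  a≢i = refl
e-diff {a = suc a} {suc i} a≢i = e-diff (a≢i ∘ cong suc)

0≤1 : 0ℚ ≤ 1ℚ
0≤1 = ≤ᵇ⇒≤ _

e-nonneg : (a i : Fin n) → 0ℚ ≤ e a i
e-nonneg zero    zero    = 0≤1
e-nonneg zero    (suc i) = ≤-refl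
e-nonneg (suc a) zero    = ≤-refl
e-nonneg (suc a) (suc i) = e-nonneg a i

e-≤1 : (a i : Fin n) → e a i ≤ 1ℚ
e-≤1 zero    zero    = ≤-refl
e-≤1 zero    (suc i) = 0≤1
e-≤1 (suc a) zero    = 0≤1
e-≤1 (suc a) (suc i) = e-≤1 a i

Σ-e* : (a : Fin n) (f : Fin n → ℚ) → Σᶠ n (λ i → e a i * f i) ≡ f a
Σ-e* {suc n} zero f = trans
  (cong₂ _+_ (*-identityˡ (f zero)) (trans (Σ-cong (λ i → *-zeroˡ (f (suc i)))) (Σ-zero n)))
  (+-identityʳ (f zero))
Σ-e* (suc a) f = trans (cong₂ _+_ (*-zeroˡ (f zero)) (Σ-e* a (f ∘ suc))) (+-identityˡ _)

Σ-e : (a : Fin n) → Σᶠ n (e a) ≡ 1ℚ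
Σ-e a = trans (Σ-cong (λ i → sym (*-identityʳ (e a i)))) (Σ-e* a (λ _ → 1ℚ))

-- Fraction-free elimination of the first column with pivot row p.
kernel : ∀ m (A : Fin (suc m) → Fin m → ℚ) →
         Σ (Fin (suc m) → ℚ) λ μ →
           (∃ λ k → μ k ≢ 0ℚ) × (∀ i → Σᶠ (suc m) (λ k → μ k * A k i) ≡ 0ℚ)
kernel zero    A = (λ _ → 1ℚ) , (zero , 1≢0) , λ ()
kernel (suc m) A with Fin.any? (λ k → ¬? (A k zero ℚ.≟ 0ℚ))
-- When the first column vanishes, row `zero` is spare: it gets coefficient 0, and the other rows
-- face one column fewer.
... | no all-zero = 0ℚ ◂ proj₁ rec , (suc (proj₁ nonzero) , proj₂ nonzero) , λ where
    zero    → trans (Σ-cong (λ k → trans (cong ((0ℚ ◂ proj₁ rec) k *_) (first-zero k)) (*-zeroʳ ((0ℚ ◂ proj₁ rec) k))))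
                    (Σ-zero (suc (suc m)))
    (suc i) → trans (cong₂ _+_ (*-zeroˡ (A zero (suc i))) (proj₂ (proj₂ rec) i)) (+-identityˡ 0ℚ)
  where
  rec = kernel m (λ k i → A (suc k) (suc i))
  nonzero = proj₁ (proj₂ rec)
  first-zero : ∀ k → A k zero ≡ 0ℚ
  first-zero k = decidable-stable (A k zero ℚ.≟ 0ℚ) (λ ≢0 → all-zero (k , ≢0))
... | yes (p , a≢0) = μ , (punchIn p (proj₁ nonzero) , μ≢0) , column
  where
  open ≡-Reasoning
  a = A p zero
  b : Fin (suc m) → ℚ
  b k = A (punchIn p k) zero
  rec = kernel m (λ k i → a * A (punchIn p k) (suc i) - b k * A p (suc i))
  μ′ = proj₁ rec
  nonzero = proj₁ (proj₂ rec)
  -- The other rows enter with `a * μ′ k`, so weight `- s` on the pivot row cancels the first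
  -- column.
  s = Σᶠ (suc m) (λ k → μ′ k * b k)
  μ : Fin (suc (suc m)) → ℚ
  μ = insertAt (λ k → a * μ′ k) p (- s)
  μ≢0 : μ (punchIn p (proj₁ nonzero)) ≢ 0ℚ
  μ≢0 eq = proj₂ nonzero (*-cancel-zero a≢0
    (trans (sym (insertAt-punchIn (λ k → a * μ′ k) p (- s) (proj₁ nonzero))) eq))
  split : ∀ i → Σᶠ (suc (suc m)) (λ k → μ k * A k i) ≡
                - s * A p i + a * Σᶠ (suc m) (λ k → μ′ k * A (punchIn p k) i)
  split i = trans (Σ-punchIn p (λ k → μ k * A k i)) (cong₂ _+_
    (cong (_* A p i) (insertAt-lookup (λ k → a * μ′ k) p (- s)))
    (trans (Σ-cong (λ k → trans (cong (_* A (punchIn p k) i) (insertAt-punchIn (λ k → a * μ′ k) p (- s) k))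
                                (*-assoc a (μ′ k) _)))
           (Σ-*ˡ a (λ k → μ′ k * A (punchIn p k) i))))
  column : ∀ i → Σᶠ (suc (suc m)) (λ k → μ k * A k i) ≡ 0ℚ
  column zero = trans (split zero) (lemma s a)
    where
    lemma : ∀ s a → - s * a + a * s ≡ 0ℚ
    lemma = solve-∀ ℚ-ring
  column (suc i) = begin
    Σᶠ (suc (suc m)) (λ k → μ k * A k (suc i))
      ≡⟨ split (suc i) ⟩
    - s * c + a * Σᶠ (suc m) (λ k → μ′ k * A (punchIn p k) (suc i))
      ≡⟨ lemma₁ s c (a * Σᶠ (suc m) (λ k → μ′ k * A (punchIn p k) (suc i))) ⟩
    a * Σᶠ (suc m) (λ k → μ′ k * A (punchIn p k) (suc i)) + (- c) * s
      ≡⟨ cong₂ _+_ (Σ-*ˡ a (λ k → μ′ k * A (punchIn p k) (suc i))) (Σ-*ˡ (- c) (λ k → μ′ k * b k)) ⟨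
    Σᶠ (suc m) (λ k → a * (μ′ k * A (punchIn p k) (suc i))) + Σᶠ (suc m) (λ k → (- c) * (μ′ k * b k))
      ≡⟨ Σ-+ (λ k → a * (μ′ k * A (punchIn p k) (suc i))) (λ k → (- c) * (μ′ k * b k)) ⟨
    Σᶠ (suc m) (λ k → a * (μ′ k * A (punchIn p k) (suc i)) + (- c) * (μ′ k * b k))
      ≡⟨ Σ-cong (λ k → lemma₂ a (μ′ k) (A (punchIn p k) (suc i)) c (b k)) ⟩
    Σᶠ (suc m) (λ k → μ′ k * (a * A (punchIn p k) (suc i) - b k * c))
      ≡⟨ proj₂ (proj₂ rec) i ⟩
    0ℚ ∎
    where
    c = A p (suc i)
    lemma₁ : ∀ s c t → - s * c + t ≡ t + (- c) * s
    lemma₁ = solve-∀ ℚ-ring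
    lemma₂ : ∀ a u x c v → a * (u * x) + (- c) * (u * v) ≡ u * (a * x - v * c)
    lemma₂ = solve-∀ ℚ-ring

InSpan : (Fin m → Point n) → Point n → Set
InSpan {m} B x = Σ (Fin m → ℚ) λ α → ∀ i → x i ≡ Σᶠ m (λ j → α j * B j i)

module _ (B : Fin m → Point n) where

  span-resp : {x y : Point n} → x ≈ₚ y → InSpan B x → InSpan B y
  span-resp x≈y (α , eq) = α , λ i → trans (sym (x≈y i)) (eq i)

  span-zero : InSpan B (λ _ → 0ℚ)
  span-zero = (λ _ → 0ℚ) , λ i → sym (trans (Σ-cong (λ j → *-zeroˡ (B j i))) (Σ-zero m))

  span-+ : {x y : Point n} → InSpan B x → InSpan B y → InSpan B (λ i → x i + y i)
  span-+ (α , eqα) (β , eqβ) = (λ j → α j + β j) , λ i →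
    trans (cong₂ _+_ (eqα i) (eqβ i))
      (trans (sym (Σ-+ (λ j → α j * B j i) (λ j → β j * B j i)))
             (Σ-cong (λ j → sym (*-distribʳ-+ (B j i) (α j) (β j)))))

  span-* : ∀ a {x : Point n} → InSpan B x → InSpan B (λ i → a * x i)
  span-* a (α , eq) = (λ j → a * α j) , λ i →
    trans (cong (a *_) (eq i))
      (trans (sym (Σ-*ˡ a (λ j → α j * B j i))) (Σ-cong (λ j → sym (*-assoc a (α j) (B j i)))))

  span-Σ : ∀ k {x : Fin k → Point n} → (∀ l → InSpan B (x l)) → InSpan B (λ i → Σᶠ k (λ l → x l i))
  span-Σ zero    mem = span-zero
  span-Σ (suc k) mem = span-+ (mem zero) (span-Σ k (mem ∘ suc))

  span-generator : ∀ j → InSpan B (B j)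
  span-generator j = e j , λ i → sym (Σ-e* j (λ l → B l i))

span-trans : (B : Fin m → Point n) (C : Fin k → Point n) → (∀ j → InSpan C (B j)) →
             ∀ {x} → InSpan B x → InSpan C x
span-trans {m = m} B C B⊆C (α , eq) =
  span-resp C (λ i → sym (eq i)) (span-Σ C m (λ j → span-* C (α j) (B⊆C j)))

-- `HasDim S k` is `HasAffInd S k` together with the negation of `HasAffInd S (suc k)`.
HasAffInd : (Point n → Set) → ℕ → Set
HasAffInd {n} S k = Σ (Fin (suc k) → Point n) λ p → (∀ j → S (p j)) × AffInd p

-- The `m + 2` coefficient vectors of length `m`, each preceded by a 1, are linearly dependent; the
-- extra coordinate makes the coefficients of the dependency sum to zero, so that the relation is
-- affine and the base point `x` cancels.
span⇒¬affInd : (S : Point n → Set) (x : Point n) (B : Fin m → Point n) →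
  (∀ y → S y → InSpan B (λ i → y i - x i)) →
  ¬ HasAffInd S (suc m)
span⇒¬affInd {n} {m} S x B S⊆span (p , p∈S , aff) = proj₂ nonzero (aff μ Σμ≡0 combination (proj₁ nonzero))
  where
  open ≡-Reasoning
  α : Fin (suc (suc m)) → Fin m → ℚ
  α k = proj₁ (S⊆span (p k) (p∈S k))
  ker = kernel (suc m) (λ k → 1ℚ ◂ α k)
  μ = proj₁ ker
  nonzero = proj₁ (proj₂ ker)
  Σμ≡0 : Σᶠ (suc (suc m)) μ ≡ 0ℚ
  Σμ≡0 = trans (Σ-cong (λ k → sym (*-identityʳ (μ k)))) (proj₂ (proj₂ ker) zero)
  combination : ∀ i → Σᶠ (suc (suc m)) (λ k → μ k * p k i) ≡ 0ℚ
  combination i = begin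
    Σᶠ (suc (suc m)) (λ k → μ k * p k i)
      ≡⟨ Σ-cong (λ k → trans (lemma (μ k) (p k i) (x i))
           (cong (λ t → μ k * x i + μ k * t) (proj₂ (S⊆span (p k) (p∈S k)) i))) ⟩
    Σᶠ (suc (suc m)) (λ k → μ k * x i + μ k * Σᶠ m (λ j → α k j * B j i))
      ≡⟨ Σ-+ (λ k → μ k * x i) (λ k → μ k * Σᶠ m (λ j → α k j * B j i)) ⟩
    Σᶠ (suc (suc m)) (λ k → μ k * x i) + Σᶠ (suc (suc m)) (λ k → μ k * Σᶠ m (λ j → α k j * B j i))
      ≡⟨ cong₂ _+_ (trans (Σ-*ʳ (x i) μ) (trans (cong (_* x i) Σμ≡0) (*-zeroˡ (x i))))
           (Σ-cong (λ k → trans (sym (Σ-*ˡ (μ k) (λ j → α k j * B j i)))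
                                (Σ-cong (λ j → sym (*-assoc (μ k) (α k j) (B j i)))))) ⟩
    0ℚ + Σᶠ (suc (suc m)) (λ k → Σᶠ m (λ j → μ k * α k j * B j i))
      ≡⟨ +-identityˡ _ ⟩
    Σᶠ (suc (suc m)) (λ k → Σᶠ m (λ j → μ k * α k j * B j i))
      ≡⟨ Σ-swap (λ k j → μ k * α k j * B j i) ⟩
    Σᶠ m (λ j → Σᶠ (suc (suc m)) (λ k → μ k * α k j * B j i))
      ≡⟨ Σ-cong (λ j → trans (Σ-*ʳ (B j i) (λ k → μ k * α k j))
           (trans (cong (_* B j i) (proj₂ (proj₂ ker) (suc j))) (*-zeroˡ (B j i)))) ⟩
    Σᶠ m (λ j → 0ℚ)
      ≡⟨ Σ-zero m ⟩
    0ℚ ∎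
    where
    lemma : ∀ u y x → u * y ≡ u * x + u * (y - x)
    lemma = solve-∀ ℚ-ring

LinInd : (Fin m → Point n) → Set
LinInd {m} B = (μ : Fin m → ℚ) → (∀ i → Σᶠ m (λ j → μ j * B j i) ≡ 0ℚ) → ∀ j → μ j ≡ 0ℚ

-- Subtracting the coefficient sum times `x` from an affine relation leaves a linear relation among
-- the `B j` with coefficients `ν j * t j`; the nonzero factors `t j` then cancel.
linInd⇒affInd : (x : Point n) {B p : Fin m → Point n} (t : Fin m → ℚ) → (∀ j → t j ≢ 0ℚ) →
  (∀ j i → p j i ≡ x i + t j * B j i) → LinInd B → AffInd (x ◂ p)
linInd⇒affInd {m = m} x {B} {p} t t≢0 shift ind μ Σμ≡0 combination = λ where
    zero    → trans (sym (+-identityʳ (μ zero)))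
                (trans (cong (μ zero +_) (sym (trans (Σ-cong tail≡0) (Σ-zero m)))) Σμ≡0)
    (suc j) → tail≡0 j
  where
  open ≡-Reasoning
  ν : Fin m → ℚ
  ν j = μ (suc j)
  relation : ∀ i → Σᶠ m (λ j → ν j * t j * B j i) ≡ 0ℚ
  relation i = begin
    Σᶠ m (λ j → ν j * t j * B j i)
      ≡⟨ lemma₁ (Σᶠ m (λ j → ν j * t j * B j i)) (μ zero) (Σᶠ m ν) (x i) ⟩
    (μ zero * x i + (Σᶠ m ν * x i + Σᶠ m (λ j → ν j * t j * B j i))) - (μ zero + Σᶠ m ν) * x i
      ≡⟨ cong₂ (λ u v → (μ zero * x i + u) - v * x i)
           (trans (cong (_+ Σᶠ m (λ j → ν j * t j * B j i)) (sym (Σ-*ʳ (x i) ν)))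
             (trans (sym (Σ-+ (λ j → ν j * x i) (λ j → ν j * t j * B j i)))
               (Σ-cong (λ j → trans (lemma₂ (ν j) (x i) (t j) (B j i)) (cong (ν j *_) (sym (shift j i)))))))
           Σμ≡0 ⟩
    (μ zero * x i + Σᶠ m (λ j → ν j * p j i)) - 0ℚ * x i
      ≡⟨ cong (_- 0ℚ * x i) (combination i) ⟩
    0ℚ - 0ℚ * x i
      ≡⟨ lemma₃ (x i) ⟩
    0ℚ ∎
    where
    lemma₁ : ∀ s a b x → s ≡ (a * x + (b * x + s)) - (a + b) * x
    lemma₁ = solve-∀ ℚ-ring
    lemma₂ : ∀ v x t b → v * x + v * t * b ≡ v * (x + t * b)
    lemma₂ = solve-∀ ℚ-ring
    lemma₃ : ∀ x → 0ℚ - 0ℚ * x ≡ 0ℚ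
    lemma₃ = solve-∀ ℚ-ring
  tail≡0 : ∀ j → ν j ≡ 0ℚ
  tail≡0 j = *-cancel-zero (t≢0 j) (trans (*-comm (t j) (ν j)) (ind (λ j → ν j * t j) relation j))

affInd-pred : (S : Point n → Set) → HasAffInd S (suc k) → HasAffInd S k
affInd-pred {k = k} S (p , p∈S , aff) = p ∘ suc , p∈S ∘ suc , λ μ Σμ≡0 combination j →
  aff (0ℚ ◂ μ) (trans (+-identityˡ (Σᶠ (suc k) μ)) Σμ≡0)
    (λ i → trans (cong₂ _+_ (*-zeroˡ (p zero i)) (combination i)) (+-identityˡ 0ℚ)) (suc j)

affInd-≤ : (S : Point n → Set) → k ℕ.≤′ m → HasAffInd S m → HasAffInd S k
affInd-≤ S (ℕ.≤′-reflexive refl) aff = aff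
affInd-≤ S (ℕ.≤′-step k≤m)       aff = affInd-≤ S k≤m (affInd-pred S aff)

HasDim-unique : (S : Point n → Set) → HasDim S k → HasDim S m → k ≡ m
HasDim-unique {k = k} {m} S (affₖ , ¬affₖ) (affₘ , ¬affₘ) with ℕ.<-cmp k m
... | tri< k<m _ _ = ⊥-elim (¬affₖ (affInd-≤ S (ℕ.≤⇒≤′ k<m) affₘ))
... | tri≈ _ k≡m _ = k≡m
... | tri> _ _ m<k = ⊥-elim (¬affₘ (affInd-≤ S (ℕ.≤⇒≤′ m<k) affₖ))

point-affInd : (x : Point n) → AffInd {k = 0} (λ _ → x)
point-affInd x μ Σμ≡0 _ zero = trans (sym (+-identityʳ (μ zero))) Σμ≡0

-- Otherwise affinely independent families in S could be extended forever.
¬¬HasDim : (S : Point n → Set) (x : Point n) → S x → ∀ m → ¬ HasAffInd S m → ¬ ¬ (∃ λ d → HasDim S d)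
¬¬HasDim S x x∈S m ¬affₘ noDim = extend m ¬affₘ
  where
  extend : ∀ k → ¬ ¬ HasAffInd S k
  extend zero    ¬aff = ¬aff ((λ _ → x) , (λ _ → x∈S) , point-affInd x)
  extend (suc k) ¬aff = extend k (λ aff → noDim (k , aff , ¬aff))

-- The vectors e_b - e_a

dir : Fin n → Fin n → Point n
dir a b i = e b i - e a i

dir-self : (a i : Fin n) → dir a a i ≡ 0ℚ
dir-self a i = +-inverseʳ (e a i)

dir-head : {a b : Fin n} → a ≢ b → dir a b b ≡ 1ℚ
dir-head {a = a} {b} a≢b = cong₂ _-_ (e-same b) (e-diff a≢b)

dir-tail : {a b : Fin n} → a ≢ b → dir a b a ≡ - 1ℚ
dir-tail {a = a} {b} a≢b = cong₂ _-_ (e-diff (a≢b ∘ sym)) (e-same a)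

dir-other : {a b i : Fin n} → a ≢ i → b ≢ i → dir a b i ≡ 0ℚ
dir-other a≢i b≢i = cong₂ _-_ (e-diff b≢i) (e-diff a≢i)

·-dir : (c : Point n) (a b : Fin n) → c · dir a b ≡ c b - c a
·-dir {n} c a b = begin
  Σᶠ n (λ i → c i * (e b i - e a i))
    ≡⟨ Σ-cong (λ i → lemma₁ (c i) (e b i) (e a i)) ⟩
  Σᶠ n (λ i → e b i * c i + (- 1ℚ) * (e a i * c i))
    ≡⟨ Σ-+ (λ i → e b i * c i) (λ i → (- 1ℚ) * (e a i * c i)) ⟩
  Σᶠ n (λ i → e b i * c i) + Σᶠ n (λ i → (- 1ℚ) * (e a i * c i))
    ≡⟨ cong₂ _+_ (Σ-e* b c) (trans (Σ-*ˡ (- 1ℚ) (λ i → e a i * c i)) (cong ((- 1ℚ) *_) (Σ-e* a c))) ⟩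
  c b + (- 1ℚ) * c a
    ≡⟨ lemma₂ (c b) (c a) ⟩
  c b - c a ∎
  where
  open ≡-Reasoning
  lemma₁ : ∀ c b a → c * (b - a) ≡ b * c + (- 1ℚ) * (a * c)
  lemma₁ = solve-∀ ℚ-ring
  lemma₂ : ∀ x y → x + (- 1ℚ) * y ≡ x - y
  lemma₂ = solve-∀ ℚ-ring

·-cong : (c : Point n) {x y : Point n} → x ≈ₚ y → c · x ≡ c · y
·-cong c x≈y = Σ-cong (λ i → cong (c i *_) (x≈y i))

·-linear : (c x y : Point n) (t : ℚ) → c · (λ i → x i + t * y i) ≡ c · x + t * (c · y)
·-linear c x y t = trans (Σ-cong (λ i → lemma (c i) (x i) t (y i)))
  (trans (Σ-+ (λ i → c i * x i) (λ i → t * (c i * y i)))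
         (cong (c · x +_) (Σ-*ˡ t (λ i → c i * y i))))
  where
  lemma : ∀ c x t y → c * (x + t * y) ≡ c * x + t * (c * y)
  lemma = solve-∀ ℚ-ring

·-Σ : (c : Point n) (x : Fin m → Point n) → c · (λ i → Σᶠ m (λ j → x j i)) ≡ Σᶠ m (λ j → c · x j)
·-Σ {m = m} c x = trans (Σ-cong (λ i → sym (Σ-*ˡ (c i) (λ j → x j i)))) (Σ-swap (λ i j → c i * x j i))

-1≢0 : - 1ℚ ≢ 0ℚ
-1≢0 ()

*-annihilated : ∀ {a b} → b ≢ 0ℚ → a * b ≡ 0ℚ → a ≡ 0ℚ
*-annihilated {a} {b} b≢0 ab≡0 = *-cancel-zero b≢0 (trans (*-comm b a) ab≡0)

dir-linInd₁ : {a b : Fin n} → a ≢ b → LinInd {1} (dir a b ◂ λ ())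
dir-linInd₁ {a = a} {b} a≢b μ relation zero =
  *-annihilated (λ eq → 1≢0 (trans (sym (dir-head a≢b)) eq)) (trans (sym (+-identityʳ _)) (relation b))

-- Some coordinate vanishes on the second vector but not on the first.
dir-linInd₂ : {a b a′ b′ : Fin n} → a ≢ b → a′ ≢ b′ → ¬ (a ≡ a′ × b ≡ b′) → ¬ (a ≡ b′ × b ≡ a′) →
              LinInd {2} (dir a b ◂ dir a′ b′ ◂ λ ())
dir-linInd₂ {a = a} {b} {a′} {b′} a≢b a′≢b′ ≢same ≢opposite μ relation = λ where
    zero       → μ₀≡0
    (suc zero) → *-annihilated head′≢0 (trans (sym (trans (cong (λ t → t * dir a b b′ + (μ (suc zero) * dir a′ b′ b′ + 0ℚ)) μ₀≡0)
                   (lemma (dir a b b′) (μ (suc zero) * dir a′ b′ b′)))) (relation b′))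
  where
  lemma : ∀ x y → 0ℚ * x + (y + 0ℚ) ≡ y
  lemma = solve-∀ ℚ-ring
  head≢0 : dir a b b ≢ 0ℚ
  head≢0 eq = 1≢0 (trans (sym (dir-head a≢b)) eq)
  tail≢0 : dir a b a ≢ 0ℚ
  tail≢0 eq = -1≢0 (trans (sym (dir-tail a≢b)) eq)
  head′≢0 : dir a′ b′ b′ ≢ 0ℚ
  head′≢0 eq = 1≢0 (trans (sym (dir-head a′≢b′)) eq)
  at : ∀ i → dir a b i ≢ 0ℚ → dir a′ b′ i ≡ 0ℚ → μ zero ≡ 0ℚ
  at i ≢0 ≡0 = *-annihilated ≢0 (trans (sym (trans
    (cong (λ t → μ zero * dir a b i + (μ (suc zero) * t + 0ℚ)) ≡0) (lemma₂ _ (μ (suc zero))))) (relation i))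
    where
    lemma₂ : ∀ x y → x + (y * 0ℚ + 0ℚ) ≡ x
    lemma₂ = solve-∀ ℚ-ring
  μ₀≡0 : μ zero ≡ 0ℚ
  μ₀≡0 with b Fin.≟ b′ | b Fin.≟ a′
  ... | yes refl | _        = at a tail≢0 (dir-other (λ a′≡a → ≢same (sym a′≡a , refl)) (a≢b ∘ sym))
  ... | no b≢b′  | yes refl = at a tail≢0 (dir-other (a≢b ∘ sym) (λ b′≡a → ≢opposite (sym b′≡a , refl)))
  ... | no b≢b′  | no b≢a′  = at b head≢0 (dir-other (b≢a′ ∘ sym) (b≢b′ ∘ sym))

-- Relations on a finite set

module _ {A : Set} {R : A → A → Set} where

  -- As in Warshall's algorithm, Via xs is connectedness by R-paths with inner vertices in xs.
  Via : List A → A → A → Set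
  Via []       = R
  Via (x ∷ xs) a b = Via xs a b ⊎ (Via xs a x × Via xs x b)

  via-edge : ∀ xs {a b} → R a b → Via xs a b
  via-edge []       r = r
  via-edge (x ∷ xs) r = inj₁ (via-edge xs r)

  -- Where both halves pass through the same `x`, only the part up to its first visit and the part
  -- after its last are kept; the closed stretch in between is dropped.
  via-trans : ∀ {xs a b w} → w ∈ₗ xs → Via xs a w → Via xs w b → Via xs a b
  via-trans (here refl) (inj₁ p)       (inj₁ q)       = inj₂ (p , q)
  via-trans (here refl) (inj₁ p)       (inj₂ (_ , q)) = inj₂ (p , q)
  via-trans (here refl) (inj₂ (p , _)) (inj₁ q)       = inj₂ (p , q)
  via-trans (here refl) (inj₂ (p , _)) (inj₂ (_ , q)) = inj₂ (p , q)
  via-trans (there w∈)  (inj₁ p)       (inj₁ q)       = inj₁ (via-trans w∈ p q)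
  via-trans (there w∈)  (inj₁ p)       (inj₂ (q , r)) = inj₂ (via-trans w∈ p q , r)
  via-trans (there w∈)  (inj₂ (p , q)) (inj₁ r)       = inj₂ (p , via-trans w∈ q r)
  via-trans (there w∈)  (inj₂ (p , _)) (inj₂ (_ , r)) = inj₂ (p , r)

  via⇒closure : ∀ xs {a b} → Via xs a b → TransClosure R a b
  via⇒closure []       r              = [ r ]
  via⇒closure (x ∷ xs) (inj₁ p)       = via⇒closure xs p
  via⇒closure (x ∷ xs) (inj₂ (p , q)) = via⇒closure xs p ++ via⇒closure xs q

  closure⇒via : ∀ {xs} → (∀ a → a ∈ₗ xs) → ∀ {a b} → TransClosure R a b → Via xs a b
  closure⇒via {xs} all [ r ]              = via-edge xs r
  closure⇒via {xs} all (_∷_ {y = w} r rs) = via-trans (all w) (via-edge xs r) (closure⇒via all rs)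

  via? : (∀ a b → Dec (R a b)) → ∀ xs a b → Dec (Via xs a b)
  via? R? []       a b = R? a b
  via? R? (x ∷ xs) a b = via? R? xs a b ⊎-dec (via? R? xs a x ×-dec via? R? xs x b)

closure? : {R : Fin n → Fin n → Set} → (∀ a b → Dec (R a b)) → ∀ a b → Dec (TransClosure R a b)
closure? R? a b = map′ (via⇒closure (allFin _)) (closure⇒via ∈-allFin) (via? R? (allFin _) a b)

module _ {A : Set} (_≺_ : A → A → Set) where

  Covers : A → A → Set
  Covers a b = (a ≺ b) × ¬ (∃ λ w → (a ≺ w) × (w ≺ b))

  -- Recursion on a list containing everything strictly between `a` and `b`. If `x` lies between,
  -- the relation is split at `x`, and irreflexivity removes `x` from the list of both halves; once
  -- the list is empty the pair is a cover.
  refine-to-covers : (∀ {a b c} → a ≺ b → b ≺ c → a ≺ c) → (∀ a → ¬ a ≺ a) →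
    (∀ a b → Dec (a ≺ b)) → ∀ xs {a b} → (∀ w → a ≺ w → w ≺ b → w ∈ₗ xs) →
    a ≺ b → TransClosure Covers a b
  refine-to-covers ≺-trans ≺-irrefl _≺?_ []       between⊆ a≺b =
    [ a≺b , (λ (w , a≺w , w≺b) → case-[] (between⊆ w a≺w w≺b)) ]
    where
    case-[] : ∀ {w} → ¬ w ∈ₗ []
    case-[] ()
  refine-to-covers ≺-trans ≺-irrefl _≺?_ (x ∷ xs) {a} {b} between⊆ a≺b with (a ≺? x) ×-dec (x ≺? b)
  ... | yes (a≺x , x≺b) =
    refine-to-covers ≺-trans ≺-irrefl _≺?_ xs
      (λ w a≺w w≺x → remove w (λ { refl → ≺-irrefl w w≺x }) (between⊆ w a≺w (≺-trans w≺x x≺b))) a≺x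
    ++
    refine-to-covers ≺-trans ≺-irrefl _≺?_ xs
      (λ w x≺w w≺b → remove w (λ { refl → ≺-irrefl w x≺w }) (between⊆ w (≺-trans a≺x x≺w) w≺b)) x≺b
    where
    remove : ∀ w → w ≢ x → w ∈ₗ x ∷ xs → w ∈ₗ xs
    remove w w≢x (here w≡x) = ⊥-elim (w≢x w≡x)
    remove w w≢x (there w∈) = w∈
  ... | no ¬between = refine-to-covers ≺-trans ≺-irrefl _≺?_ xs
    (λ w a≺w w≺b → remove (between⊆ w a≺w w≺b) a≺w w≺b) a≺b
    where
    remove : ∀ {w} → w ∈ₗ x ∷ xs → a ≺ w → w ≺ b → w ∈ₗ xs
    remove (here refl) a≺w w≺b = ⊥-elim (¬between (a≺w , w≺b))
    remove (there w∈)  _   _   = w∈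

-- Simple walks

lookup-injective : {A : Set} {xs : List A} → Unique xs → Injective _≡_ _≡_ (lookup xs)
lookup-injective (x∉ ∷ uniq) {zero}  {zero}  eq = refl
lookup-injective {xs = _ ∷ xs} (x∉ ∷ uniq) {zero}  {suc j} eq = ⊥-elim (All.lookup x∉ (∈-lookup {xs = xs} j) eq)
lookup-injective {xs = _ ∷ xs} (x∉ ∷ uniq) {suc i} {zero}  eq = ⊥-elim (All.lookup x∉ (∈-lookup {xs = xs} i) (sym eq))
lookup-injective (x∉ ∷ uniq) {suc i} {suc j} eq = cong suc (lookup-injective uniq eq)

module _ {A : Set} (R : A → A → Set) where

  -- The index lists all vertices of the walk, both ends included, so that its `lookup` can serve
  -- directly as the vertex sequence of a cycle.
  data Walk : A → A → List A → Set where
    stop : ∀ {a} → Walk a a (a ∷ [])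
    step : ∀ {a b c xs} → R a b → Walk b c xs → Walk a c (a ∷ xs)

  walk-first : ∀ {a b x xs} → Walk a b (x ∷ xs) → x ≡ a
  walk-first stop       = refl
  walk-first (step _ _) = refl

  walk-last : ∀ {a b x xs} → Walk a b (x ∷ xs) → lookup (x ∷ xs) (fromℕ (length xs)) ≡ b
  walk-last stop                    = refl
  walk-last (step {xs = _ ∷ _} _ w) = walk-last w

  walk-step : ∀ {a b x xs} → Walk a b (x ∷ xs) → ∀ (i : Fin (length xs)) →
              R (lookup (x ∷ xs) (inject₁ i)) (lookup xs i)
  walk-step {xs = _ ∷ _} (step r w) zero    = subst (R _) (sym (walk-first w)) r
  walk-step {xs = _ ∷ _} (step r w) (suc i) = walk-step w i

  walk-suffix : ∀ {a b x xs} → Walk a b xs → Unique xs → x ∈ₗ xs → ∃ λ ys → Walk x b ys × Unique ys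
  walk-suffix stop       uniq       (here refl) = _ , stop , uniq
  walk-suffix (step r w) uniq       (here refl) = _ , step r w , uniq
  walk-suffix (step r w) (_ ∷ uniq) (there x∈)  = walk-suffix w uniq x∈

  module _ (_≟_ : DecidableEquality A) where

    -- Loop erasure: if `a` already occurs on the simple walk, the suffix starting there replaces
    -- the whole.
    simple-step : ∀ {a b c} → R a b → (∃ λ xs → Walk b c xs × Unique xs) →
                  ∃ λ xs → Walk a c xs × Unique xs
    simple-step {a} r (xs , w , uniq) with _∈?ₗ_ _≟_ a xs
    ... | yes a∈ = walk-suffix w uniq a∈
    ... | no  a∉ = a ∷ xs , step r w , ¬Any⇒All¬ xs a∉ ∷ uniq

    simple-walk : ∀ {a b} → TransClosure R a b → ∃ λ xs → Walk a b xs × Unique xs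
    simple-walk [ r ]    = simple-step r (_ , stop , [] ∷ [])
    simple-walk (r ∷ rs) = simple-step r (simple-walk rs)

-- A potential f separating the endpoints of the j₀-th edge and no others reads off the coefficient μ j₀.
cuts⇒linInd : (src tgt : Fin m → Fin n) →
  (∀ j₀ → Σ (Fin n → ℚ) λ f →
    (∀ j → j ≢ j₀ → f (src j) ≡ f (tgt j)) × f (src j₀) ≡ 0ℚ × f (tgt j₀) ≡ 1ℚ) →
  LinInd (λ j → dir (src j) (tgt j))
cuts⇒linInd {m} {n} src tgt cut μ relation j₀ = begin
  μ j₀
    ≡⟨ Σ-e* j₀ μ ⟨
  Σᶠ m (λ j → e j₀ j * μ j)
    ≡⟨ Σ-cong (λ j → trans (*-comm (e j₀ j) (μ j)) (cong (μ j *_) (sym (f·dir j)))) ⟩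
  Σᶠ m (λ j → μ j * (f · dir (src j) (tgt j)))
    ≡⟨ Σ-cong (λ j → trans (sym (Σ-*ˡ (μ j) (λ i → f i * dir (src j) (tgt j) i)))
                           (Σ-cong (λ i → swap (μ j) (f i) (dir (src j) (tgt j) i)))) ⟩
  Σᶠ m (λ j → f · (λ i → μ j * dir (src j) (tgt j) i))
    ≡⟨ ·-Σ f (λ j i → μ j * dir (src j) (tgt j) i) ⟨
  f · (λ i → Σᶠ m (λ j → μ j * dir (src j) (tgt j) i))
    ≡⟨ ·-cong f relation ⟩
  f · (λ _ → 0ℚ)
    ≡⟨ trans (Σ-cong (λ i → *-zeroʳ (f i))) (Σ-zero n) ⟩
  0ℚ ∎
  where
  open ≡-Reasoning
  f = proj₁ (cut j₀)
  swap : ∀ u v w → u * (v * w) ≡ v * (u * w)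
  swap u v w = trans (sym (*-assoc u v w)) (trans (cong (_* w) (*-comm u v)) (*-assoc v u w))
  f·dir : ∀ j → f · dir (src j) (tgt j) ≡ e j₀ j
  f·dir j with j Fin.≟ j₀
  ... | yes refl = trans (·-dir f (src j) (tgt j)) (trans
        (cong₂ _-_ (proj₂ (proj₂ (proj₂ (cut j)))) (proj₁ (proj₂ (proj₂ (cut j)))))
        (sym (e-same j)))
  ... | no j≢j₀ = trans (·-dir f (src j) (tgt j)) (trans
        (cong (λ t → f (tgt j) - t) (proj₁ (proj₂ (cut j₀)) j j≢j₀))
        (trans (+-inverseʳ (f (tgt j))) (sym (e-diff (j≢j₀ ∘ sym)))))

-- Order on ℚ, indicators and counting

*-nonneg : ∀ {a b} → 0ℚ ≤ a → 0ℚ ≤ b → 0ℚ ≤ a * b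
*-nonneg {a} {b} 0≤a 0≤b = nonNegative⁻¹ (a * b)
  {{nonNeg*nonNeg⇒nonNeg a {{nonNegative 0≤a}} b {{nonNegative 0≤b}}}}

*-pos : ∀ {a b} → 0ℚ < a → 0ℚ < b → 0ℚ < a * b
*-pos {a} {b} 0<a 0<b = positive⁻¹ (a * b) {{pos*pos⇒pos a {{positive 0<a}} b {{positive 0<b}}}}

≤⇒0≤- : ∀ {a b} → a ≤ b → 0ℚ ≤ b - a
≤⇒0≤- {a} {b} a≤b = subst (_≤ b - a) (+-inverseʳ a) (+-monoˡ-≤ (- a) a≤b)

<⇒0<- : ∀ {a b} → a < b → 0ℚ < b - a
<⇒0<- {a} {b} a<b = subst (_< b - a) (+-inverseʳ a) (+-monoˡ-< (- a) a<b)

-≡0⇒≡ : ∀ {a b} → a - b ≡ 0ℚ → a ≡ b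
-≡0⇒≡ {a} {b} eq = trans (lemma a b) (trans (cong (_+ b) eq) (+-identityˡ b))
  where
  lemma : ∀ a b → a ≡ (a - b) + b
  lemma = solve-∀ ℚ-ring

0<1 : 0ℚ < 1ℚ
0<1 = positive⁻¹ 1ℚ

<-+1 : ∀ a → a < a + 1ℚ
<-+1 a = subst (_< a + 1ℚ) (+-identityʳ a) (+-monoʳ-< a 0<1)

+-absorb-≤ : ∀ {a b} → a + b ≤ a → b ≤ 0ℚ
+-absorb-≤ {a} {b} le = subst₂ _≤_ (lemma a b) (+-inverseˡ a) (+-monoʳ-≤ (- a) le)
  where
  lemma : ∀ a b → - a + (a + b) ≡ b
  lemma = solve-∀ ℚ-ring

indicator : {P : Set} → Dec P → ℚ
indicator (yes _) = 1ℚ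
indicator (no  _) = 0ℚ

indicator-yes : {P : Set} (P? : Dec P) → P → indicator P? ≡ 1ℚ
indicator-yes (yes _) p = refl
indicator-yes (no ¬p) p = ⊥-elim (¬p p)

indicator-no : {P : Set} (P? : Dec P) → ¬ P → indicator P? ≡ 0ℚ
indicator-no (yes p) ¬p = ⊥-elim (¬p p)
indicator-no (no _)  ¬p = refl

indicator-mono : {P Q : Set} (P? : Dec P) (Q? : Dec Q) → (P → Q) → indicator P? ≤ indicator Q?
indicator-mono (yes p) (yes q) P⇒Q = ≤-refl
indicator-mono (yes p) (no ¬q) P⇒Q = ⊥-elim (¬q (P⇒Q p))
indicator-mono (no ¬p) (yes q) P⇒Q = 0≤1
indicator-mono (no ¬p) (no ¬q) P⇒Q = ≤-refl

-- Valued in ℚ because the counts become coordinates of linear functionals.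
count : {P : Fin n → Set} → (∀ w → Dec (P w)) → ℚ
count {n} P? = Σᶠ n (λ w → indicator (P? w))

count-mono : {P Q : Fin n → Set} (P? : ∀ w → Dec (P w)) (Q? : ∀ w → Dec (Q w)) →
             (∀ w → P w → Q w) → count P? ≤ count Q?
count-mono P? Q? P⊆Q = Σ-mono-≤ (λ w → indicator-mono (P? w) (Q? w) (P⊆Q w))

count-gap : {P Q : Fin n → Set} (P? : ∀ w → Dec (P w)) (Q? : ∀ w → Dec (Q w)) →
            (∀ w → P w → Q w) → ∀ w → ¬ P w → Q w → count P? + 1ℚ ≤ count Q?
count-gap P? Q? P⊆Q w ¬Pw Qw = Σ-gap (λ v → indicator-mono (P? v) (Q? v) (P⊆Q v)) w
  (≤-reflexive (trans (cong (_+ 1ℚ) (indicator-no (P? w) ¬Pw)) (trans (+-identityˡ 1ℚ) (sym (indicator-yes (Q? w) Qw)))))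

-- Choosing and changing heads

argmax : (U : Subset n) (c : Fin n → ℚ) → Nonempty U → ∃ λ a → a ∈ U × (∀ i → i ∈ U → c i ≤ c a)
argmax (s ∷ U) c nonempty with nonempty? U
argmax (false ∷ U) c (suc i , there i∈U) | no empty = ⊥-elim (empty (i , i∈U))
argmax (true ∷ U) c _ | no empty = zero , here , λ where
  zero    _           → ≤-refl
  (suc i) (there i∈U) → ⊥-elim (empty (i , i∈U))
argmax (s ∷ U) c _ | yes nonempty with argmax U (c ∘ suc) nonempty
argmax (false ∷ U) c _ | yes _ | a , a∈U , max = suc a , there a∈U , λ where
  (suc i) (there i∈U) → max i i∈U
argmax (true ∷ U) c _ | yes _ | a , a∈U , max with ≤-total (c zero) (c (suc a))
... | inj₁ c₀≤ = suc a , there a∈U , λ where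
  zero    _           → c₀≤
  (suc i) (there i∈U) → max i i∈U
... | inj₂ ≤c₀ = zero , here , λ where
  zero    _           → ≤-refl
  (suc i) (there i∈U) → ≤-trans (max i i∈U) ≤c₀

update : {A : Set} → (Fin k → A) → Fin k → A → Fin k → A
update h j b l with l Fin.≟ j
... | yes _ = b
... | no  _ = h l

update-same : {A : Set} (h : Fin k → A) (j : Fin k) (b : A) → update h j b j ≡ b
update-same h j b with j Fin.≟ j
... | yes _   = refl
... | no  j≢j = ⊥-elim (j≢j refl)

-- Faces and vertices of P_G in terms of head selections

module Polytope {n : ℕ} (G : List (Subset n)) where

  Selection : Set
  Selection = Fin (length G) → Fin n

  -- Acyclicity is left out: altering a single head may create a cycle, but must still give a point
  -- of the polytope.
  IsChoice : Selection → Set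
  IsChoice h = ∀ j → h j ∈ lookup G j

  X : Selection → Point n
  X h i = Σᶠ (length G) (λ j → e (h j) i)

  e-inΔ : ∀ {U : Subset n} {a} → a ∈ U → InΔ U (e a)
  e-inΔ {U} {a} a∈U = e-nonneg a , (λ i i∉U → e-diff {a = a} {i} (λ { refl → i∉U a∈U })) , Σ-e a

  X-inP : ∀ {h} → IsChoice h → InP G (X h)
  X-inP {h} h∈ = (λ j → e (h j)) , (λ j → e-inΔ {a = h j} (h∈ j)) , λ i → refl

  InP-resp : ∀ {x y} → x ≈ₚ y → InP G x → InP G y
  InP-resp x≈y (ys , ys∈ , eq) = ys , ys∈ , λ i → trans (sym (x≈y i)) (eq i)

  Face-resp : ∀ c {x y} → x ≈ₚ y → Face G c x → Face G c y
  Face-resp c x≈y (x∈P , max) =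
    InP-resp x≈y x∈P , λ z z∈P → ≤-trans (max z z∈P) (≤-reflexive (·-cong c x≈y))

  Vertex-resp : ∀ {x y} → x ≈ₚ y → Vertex G x → Vertex G y
  Vertex-resp x≈y (c , face , unique) =
    c , Face-resp c x≈y face , λ z z∈ i → trans (unique z z∈ i) (x≈y i)

  Adjacent-resp : ∀ {x y z} → x ≈ₚ y → Adjacent G x z → Adjacent G y z
  Adjacent-resp x≈y (vx , vz , x≉z , c , dim , x∈ , z∈) =
    Vertex-resp x≈y vx , vz , (λ y≈z → x≉z (λ i → trans (x≈y i) (y≈z i))) ,
    c , dim , Face-resp c x≈y x∈ , z∈

  X-cong : ∀ {h h′} → (∀ j → h j ≡ h′ j) → X h ≈ₚ X h′
  X-cong eq i = Σ-cong (λ j → cong (λ a → e a i) (eq j))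

  ·-X : ∀ c h → c · X h ≡ Σᶠ (length G) (λ j → c (h j))
  ·-X c h = trans (·-Σ c (λ j → e (h j)))
    (Σ-cong (λ j → trans (Σ-cong (λ i → *-comm (c i) (e (h j) i))) (Σ-e* (h j) c)))

  -- For a choice `h` this is the combinatorial form of `X h` lying on the face of `c`, by
  -- `max⇒face` and `face⇒max`.
  Maximises : Point n → Selection → Set
  Maximises c h = ∀ j i → i ∈ lookup G j → c i ≤ c (h j)

  module _ {y : Point n} (y∈P : InP G y) (h : Selection) where
    private
      ys = proj₁ y∈P

    coeff-outside : ∀ {j i} → i ∉ lookup G j → ys j i ≡ 0ℚ
    coeff-outside {j} {i} = proj₁ (proj₂ (proj₁ (proj₂ y∈P) j)) i

    Σ-coeff : ∀ j a → Σᶠ n (λ i → ys j i * a) ≡ a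
    Σ-coeff j a = trans (Σ-*ʳ a (ys j)) (trans (cong (_* a) (proj₂ (proj₂ (proj₁ (proj₂ y∈P) j)))) (*-identityˡ a))

    deficit : (c : Point n) → Fin (length G) → Fin n → ℚ
    deficit c j i = ys j i * (c (h j) - c i)

    -- Each summand `ys j` has coordinate sum 1, so `c (h j)` is its own average with these weights;
    -- comparison with `c · ys j` leaves the deficits, none of which is negative when `h` maximises
    -- `c`.
    ·-deficit : ∀ c → c · X h ≡ c · y + Σᶠ (length G) (λ j → Σᶠ n (deficit c j))
    ·-deficit c = begin
      c · X h
        ≡⟨ ·-X c h ⟩
      Σᶠ (length G) (λ j → c (h j))
        ≡⟨ Σ-cong (λ j → trans (sym (Σ-coeff j (c (h j))))
             (trans (Σ-cong (λ i → lemma (ys j i) (c (h j)) (c i)))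
                    (Σ-+ (λ i → c i * ys j i) (deficit c j)))) ⟩
      Σᶠ (length G) (λ j → c · ys j + Σᶠ n (deficit c j))
        ≡⟨ Σ-+ (λ j → c · ys j) (λ j → Σᶠ n (deficit c j)) ⟩
      Σᶠ (length G) (λ j → c · ys j) + Σᶠ (length G) (λ j → Σᶠ n (deficit c j))
        ≡⟨ cong (_+ Σᶠ (length G) (λ j → Σᶠ n (deficit c j)))
             (trans (·-cong c (proj₂ (proj₂ y∈P))) (·-Σ c ys)) ⟨
      c · y + Σᶠ (length G) (λ j → Σᶠ n (deficit c j)) ∎
      where
      open ≡-Reasoning
      lemma : ∀ y a b → y * a ≡ b * y + y * (a - b)
      lemma = solve-∀ ℚ-ring

    -- The same averaging on vectors: `ys j` minus `e (h j)` is the sum of the `dir (h j) a`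
    -- weighted by `ys j a`.
    displacement : ∀ i → y i - X h i ≡ Σᶠ (length G) (λ j → Σᶠ n (λ a → ys j a * dir (h j) a i))
    displacement i = begin
      y i - X h i
        ≡⟨ cong (_- X h i) (trans (proj₂ (proj₂ y∈P) i) (Σ-cong (λ j → sym (summand j)))) ⟩
      Σᶠ (length G) (λ j → e (h j) i + D j) - X h i
        ≡⟨ cong (_- X h i) (Σ-+ (λ j → e (h j) i) D) ⟩
      (X h i + Σᶠ (length G) D) - X h i
        ≡⟨ lemma₁ (X h i) (Σᶠ (length G) D) ⟩
      Σᶠ (length G) D ∎
      where
      open ≡-Reasoning
      D : Fin (length G) → ℚ
      D j = Σᶠ n (λ a → ys j a * dir (h j) a i)
      lemma₁ : ∀ x d → (x + d) - x ≡ d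
      lemma₁ = solve-∀ ℚ-ring
      lemma₂ : ∀ y u v → y * u + y * (v - u) ≡ y * v
      lemma₂ = solve-∀ ℚ-ring
      e-sym : ∀ {m} (a b : Fin m) → e a b ≡ e b a
      e-sym zero    zero    = refl
      e-sym zero    (suc b) = refl
      e-sym (suc a) zero    = refl
      e-sym (suc a) (suc b) = e-sym a b
      summand : ∀ j → e (h j) i + D j ≡ ys j i
      summand j = begin
        e (h j) i + D j
          ≡⟨ cong (_+ D j) (Σ-coeff j (e (h j) i)) ⟨
        Σᶠ n (λ a → ys j a * e (h j) i) + D j
          ≡⟨ Σ-+ (λ a → ys j a * e (h j) i) (λ a → ys j a * dir (h j) a i) ⟨
        Σᶠ n (λ a → ys j a * e (h j) i + ys j a * dir (h j) a i)
          ≡⟨ Σ-cong (λ a → trans (lemma₂ (ys j a) (e (h j) i) (e a i))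
               (trans (*-comm (ys j a) (e a i)) (cong (_* ys j a) (e-sym a i)))) ⟩
        Σᶠ n (λ a → e i a * ys j a)
          ≡⟨ Σ-e* i (ys j) ⟩
        ys j i ∎

    -- Only directions of nonzero weight have to lie in the span. The lemma serves with no vector
    -- for vertices, one vector for edges and all cover directions for the whole polytope.
    displacement-span : (B : Fin m → Point n) →
      (∀ j a → ys j a ≡ 0ℚ ⊎ InSpan B (dir (h j) a)) → InSpan B (λ i → y i - X h i)
    displacement-span {m} B ok = span-resp B (λ i → sym (displacement i))
      (span-Σ B (length G) (λ j → span-Σ B n (λ a → term j a (ok j a))))
      where
      term : ∀ j a → ys j a ≡ 0ℚ ⊎ InSpan B (dir (h j) a) → InSpan B (λ i → ys j a * dir (h j) a i)
      term j a (inj₁ ≡0)  = span-resp B (λ i → sym (trans (cong (_* dir (h j) a i) ≡0) (*-zeroˡ (dir (h j) a i)))) (span-zero B)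
      term j a (inj₂ mem) = span-* B (ys j a) mem

    module _ {c : Point n} (max : Maximises c h) where

      deficit-nonneg : ∀ j i → 0ℚ ≤ deficit c j i
      deficit-nonneg j i with i ∈? lookup G j
      ... | yes i∈ = *-nonneg (proj₁ (proj₁ (proj₂ y∈P) j) i) (≤⇒0≤- (max j i i∈))
      ... | no  i∉ = ≤-reflexive (sym (trans (cong (_* (c (h j) - c i)) (coeff-outside i∉)) (*-zeroˡ (c (h j) - c i))))

      ·-maximal : c · y ≤ c · X h
      ·-maximal = subst₂ _≤_ (+-identityʳ (c · y)) (sym (·-deficit c))
        (+-monoʳ-≤ (c · y) (Σ-nonneg (λ j → Σ-nonneg (deficit-nonneg j))))

      -- The deficits are nonnegative with total at most zero, hence all vanish; where `c` is
      -- strictly smaller, the weight must be the zero factor.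
      coeff-below-max : c · X h ≤ c · y → ∀ {j i} → c i < c (h j) → ys j i ≡ 0ℚ
      coeff-below-max le {j} {i} lt = *-annihilated (λ eq → <-irrefl refl (subst (c i <_) (-≡0⇒≡ eq) lt))
        (Σ-nonneg-zero (deficit-nonneg j) (Σ-nonneg-zero (λ j → Σ-nonneg (deficit-nonneg j)) total≡0 j) i)
        where
        total≡0 : Σᶠ (length G) (λ j → Σᶠ n (deficit c j)) ≡ 0ℚ
        total≡0 = ≤-antisym (+-absorb-≤ (subst (_≤ c · y) (·-deficit c) le))
          (Σ-nonneg (λ j → Σ-nonneg (deficit-nonneg j)))

  max⇒face : ∀ {c h} → IsChoice h → Maximises c h → Face G c (X h)
  max⇒face {c} {h} h∈ max = X-inP h∈ , λ y y∈P → ·-maximal y∈P h max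

  Move : Selection → Selection → Fin n → Fin n → Set
  Move h h′ a b = ∀ j → h′ j ≡ h j ⊎ (h j ≡ a × h′ j ≡ b)

  -- Common to altering one head and to flipping a cover: `X` moves along `dir a b` by the number of
  -- hyperedges that `move` records as moved.
  module Shift (h h′ : Selection) (a b : Fin n) (move : Move h h′ a b) where

    private
      moved : ∀ {j} → h′ j ≡ h j ⊎ (h j ≡ a × h′ j ≡ b) → ℚ
      moved (inj₁ _) = 0ℚ
      moved (inj₂ _) = 1ℚ

    amount : ℚ
    amount = Σᶠ (length G) (λ j → moved (move j))

    shift : ∀ i → X h′ i ≡ X h i + amount * dir a b i
    shift i = trans (Σ-cong (λ j → summand j (move j)))
      (trans (Σ-+ (λ j → e (h j) i) (λ j → moved (move j) * dir a b i))
             (cong (X h i +_) (Σ-*ʳ (dir a b i) (λ j → moved (move j)))))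
      where
      lemma₁ : ∀ u d → u ≡ u + 0ℚ * d
      lemma₁ = solve-∀ ℚ-ring
      lemma₂ : ∀ u v → v ≡ u + 1ℚ * (v - u)
      lemma₂ = solve-∀ ℚ-ring
      summand : ∀ j (mv : h′ j ≡ h j ⊎ (h j ≡ a × h′ j ≡ b)) → e (h′ j) i ≡ e (h j) i + moved mv * dir a b i
      summand j (inj₁ eq) rewrite eq = lemma₁ (e (h j) i) (dir a b i)
      summand j (inj₂ (refl , refl)) = lemma₂ (e (h j) i) (e (h′ j) i)

    amount-pos : ∀ j → h′ j ≢ h j → 0ℚ < amount
    amount-pos j h′≢h = <-≤-trans 0<1 (subst (_≤ amount) (is-moved (move j))
      (Σ-term-≤ (λ l → moved-nonneg (move l)) j))
      where
      moved-nonneg : ∀ {l} (mv : h′ l ≡ h l ⊎ (h l ≡ a × h′ l ≡ b)) → 0ℚ ≤ moved mv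
      moved-nonneg (inj₁ _) = ≤-refl
      moved-nonneg (inj₂ _) = 0≤1
      is-moved : (mv : h′ j ≡ h j ⊎ (h j ≡ a × h′ j ≡ b)) → moved mv ≡ 1ℚ
      is-moved (inj₁ eq) = ⊥-elim (h′≢h eq)
      is-moved (inj₂ _)  = refl

    amount≢0 : ∀ j → h′ j ≢ h j → amount ≢ 0ℚ
    amount≢0 j h′≢h eq = <-irrefl (sym eq) (amount-pos j h′≢h)

    -- The coordinate at the new head `b` grows by the positive `amount`.
    X-moved : ∀ j → h′ j ≢ h j → ¬ (X h′ ≈ₚ X h)
    X-moved j h′≢h eq with move j
    ... | inj₁ h′≡h         = h′≢h h′≡h
    ... | inj₂ (refl , refl) = amount≢0 j h′≢h (begin
      amount                                            ≡⟨ lemma (X h (h′ j)) amount ⟩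
      (X h (h′ j) + amount * 1ℚ) - X h (h′ j)           ≡⟨ cong (λ d → (X h (h′ j) + amount * d) - X h (h′ j)) (dir-head (h′≢h ∘ sym)) ⟨
      (X h (h′ j) + amount * dir (h j) (h′ j) (h′ j)) - X h (h′ j)
        ≡⟨ cong (_- X h (h′ j)) (trans (sym (shift (h′ j))) (eq (h′ j))) ⟩
      X h (h′ j) - X h (h′ j)                                 ≡⟨ +-inverseʳ (X h (h′ j)) ⟩
      0ℚ ∎)
      where
      open ≡-Reasoning
      lemma : ∀ x t → t ≡ (x + t * 1ℚ) - x
      lemma = solve-∀ ℚ-ring

  update-choice : ∀ {h j b} → IsChoice h → b ∈ lookup G j → IsChoice (update h j b)
  update-choice {h} {j} h∈ b∈ l with l Fin.≟ j
  ... | yes refl = b∈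
  ... | no  _    = h∈ l

  update-move : ∀ h j b → Move h (update h j b) (h j) b
  update-move h j b l with l Fin.≟ j
  ... | yes refl = inj₂ (refl , refl)
  ... | no  _    = inj₁ refl

  module UpdateShift (h : Selection) (j : Fin (length G)) (b : Fin n) =
    Shift h (update h j b) (h j) b (update-move h j b)

  update-≢ : ∀ (h : Selection) j {b} → b ≢ h j → update h j b j ≢ h j
  update-≢ h j {b} b≢ eq = b≢ (trans (sym (update-same h j b)) eq)

  update-max : ∀ {c h j b} → Maximises c h → c b ≡ c (h j) → Maximises c (update h j b)
  update-max {c} {h} {j} {b} max eq l i i∈ with l Fin.≟ j
  ... | yes refl = ≤-trans (max l i i∈) (≤-reflexive (sym eq))
  ... | no  _    = max l i i∈

  -- Moving only the head of `j` to `i` stays in the polytope and changes the value of `c` by a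
  -- positive multiple of `c i - c (h j)`.
  face⇒max : ∀ {c h} → IsChoice h → Face G c (X h) → Maximises c h
  face⇒max {c} {h} h∈ (_ , maximal) j i i∈ with i Fin.≟ h j
  ... | yes refl = ≤-refl
  ... | no  i≢hj = ≮⇒≥ λ lt → <-irrefl refl (<-≤-trans
        (*-pos (UpdateShift.amount-pos h j i j (update-≢ h j i≢hj)) (<⇒0<- lt))
        (+-absorb-≤ (subst (_≤ c · X h) value (maximal _ (X-inP (update-choice h∈ i∈))))))
    where
    open UpdateShift h j i
    t = amount
    value : c · X (update h j i) ≡ c · X h + t * (c i - c (h j))
    value = trans (·-cong c shift)
      (trans (·-linear c (X h) (dir (h j) i) t) (cong (λ d → c · X h + t * d) (·-dir c (h j) i)))

  StrictlyMaximises : Point n → Selection → Set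
  StrictlyMaximises c h = ∀ j i → i ∈ lookup G j → i ≢ h j → c i < c (h j)

  strict⇒max : ∀ {c h} → StrictlyMaximises c h → Maximises c h
  strict⇒max {c} {h} strict j i i∈ with i Fin.≟ h j
  ... | yes refl = ≤-refl
  ... | no  i≢hj = <⇒≤ (strict j i i∈ i≢hj)

  strict⇒vertex : ∀ {c h} → IsChoice h → StrictlyMaximises c h → Vertex G (X h)
  strict⇒vertex {c} {h} h∈ strict = c , max⇒face h∈ max , λ y (y∈P , maximal) i →
    -≡0⇒≡ (proj₂ (displacement-span y∈P h noVectors
      (vanish y y∈P (maximal _ (X-inP h∈)))) i)
    where
    max = strict⇒max {c} {h} strict
    -- Being in the span of no vectors means that the displacement is zero, so `y` is `X h`.
    noVectors : Fin 0 → Point n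
    noVectors ()
    vanish : ∀ y (y∈P : InP G y) → c · X h ≤ c · y → ∀ j a → proj₁ y∈P j a ≡ 0ℚ ⊎ InSpan noVectors (dir (h j) a)
    vanish y y∈P le j a with a ∈? lookup G j | a Fin.≟ h j
    ... | _      | yes refl = inj₂ (span-resp noVectors (λ i → sym (dir-self a i)) (span-zero noVectors))
    ... | yes a∈ | no a≢    = inj₁ (coeff-below-max y∈P h max le (strict j a a∈ a≢))
    ... | no a∉  | no a≢    = inj₁ (coeff-outside y∈P h a∉)

  path-decreases : ∀ c h → StrictlyMaximises c h → ∀ {u v} → Path G h u v → c v < c u
  path-decreases c h strict [ j , refl , v∈ , v≢u ]     = strict j _ v∈ v≢u
  path-decreases c h strict ((j , refl , v∈ , v≢u) ∷ p) = <-trans (path-decreases c h strict p) (strict j _ v∈ v≢u)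

  path-weakly-decreases : ∀ c h → Maximises c h → ∀ {u v} → Path G h u v → c v ≤ c u
  path-weakly-decreases c h max [ j , refl , v∈ , v≢u ]     = max j _ v∈
  path-weakly-decreases c h max ((j , refl , v∈ , v≢u) ∷ p) = ≤-trans (path-weakly-decreases c h max p) (max j _ v∈)

  -- Heads are picked where `c` is maximal. A tie at `i` would let the head move to `i` and yield a
  -- second point on the face.
  vertex⇒strict : (∀ j → Nonempty (lookup G j)) → ∀ {v : Point n} ((c , _) : Vertex G v) →
    Σ Selection λ h → IsChoice h × StrictlyMaximises c h × v ≈ₚ X h
  vertex⇒strict nonempty {v} (c , face , unique) = h , h∈ , strict , v≈X
    where
    best = λ j → argmax (lookup G j) c (nonempty j)
    h : Selection
    h j = proj₁ (best j)
    h∈ : IsChoice h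
    h∈ j = proj₁ (proj₂ (best j))
    max : Maximises c h
    max j = proj₂ (proj₂ (best j))
    v≈X : v ≈ₚ X h
    v≈X i = sym (unique (X h) (max⇒face h∈ max) i)
    strict : StrictlyMaximises c h
    strict j i i∈ i≢ = ≰⇒> λ ≤ci → UpdateShift.X-moved h j i j (update-≢ h j i≢) (λ l → trans
      (unique _ (max⇒face (update-choice h∈ i∈) (update-max max (≤-antisym (max j i i∈) ≤ci))) l)
      (v≈X l))

  vertex⇒O₀ : (∀ j → Nonempty (lookup G j)) → ∀ {v : Point n} → Vertex G v →
    Σ Selection λ h → InO₀ G h × v ≈ₚ X h
  vertex⇒O₀ nonempty vertex@(c , _) =
    let h , h∈ , strict , v≈X = vertex⇒strict nonempty vertex
    in h , (h∈ , λ u p → <-irrefl refl (path-decreases c h strict p)) , v≈X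

hyperedge-nonempty : {U : Subset n} → 2 ℕ.≤ ∣ U ∣ → Nonempty U
hyperedge-nonempty {n} {U} 2≤ with nonempty? U
... | yes nonempty = nonempty
... | no  empty with subst (2 ℕ.≤_) (trans (cong ∣_∣ (Empty-unique empty)) (∣⊥∣≡0 n)) 2≤
... | ()

-- Directed graphs with edges src j → tgt j

module _ (src tgt : Fin m → Fin n) where

  edges : Fin m → Point n
  edges j = dir (src j) (tgt j)

  Joins : Fin m → Fin n → Fin n → Set
  Joins j a b = (src j ≡ a × tgt j ≡ b) ⊎ (src j ≡ b × tgt j ≡ a)

  -- Avoidance is by index: another edge with the same ends still counts as a link.
  LinkedAvoiding : Fin m → Fin n → Fin n → Set
  LinkedAvoiding j₀ a b = ∃ λ j → j ≢ j₀ × Joins j a b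

  linkedAvoiding? : ∀ j₀ a b → Dec (LinkedAvoiding j₀ a b)
  linkedAvoiding? j₀ a b = Fin.any? (λ j → ¬? (j Fin.≟ j₀) ×-dec
    (((src j Fin.≟ a) ×-dec (tgt j Fin.≟ b)) ⊎-dec ((src j Fin.≟ b) ×-dec (tgt j Fin.≟ a))))

  -- The component of `tgt j₀` once edge `j₀` is deleted; the equality supplies the reflexivity that
  -- `TransClosure` lacks.
  Reaches : Fin m → Fin n → Set
  Reaches j₀ i = tgt j₀ ≡ i ⊎ TransClosure (LinkedAvoiding j₀) (tgt j₀) i

  reaches? : ∀ j₀ i → Dec (Reaches j₀ i)
  reaches? j₀ i = (tgt j₀ Fin.≟ i) ⊎-dec closure? (linkedAvoiding? j₀) (tgt j₀) i

  reaches-step : ∀ {j₀ a b} → LinkedAvoiding j₀ a b → Reaches j₀ a → Reaches j₀ b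
  reaches-step link (inj₁ refl) = inj₂ [ link ]
  reaches-step link (inj₂ path) = inj₂ (path ++ [ link ])

  -- The potential is the indicator of the component of `tgt j₀` without `j₀`: no other edge leaves
  -- it, and `src j₀` lies outside.
  bridges⇒linInd : (∀ j₀ → ¬ Reaches j₀ (src j₀)) → LinInd edges
  bridges⇒linInd bridge = cuts⇒linInd src tgt λ j₀ →
    (λ i → indicator (reaches? j₀ i)) ,
    (λ j j≢j₀ → ≤-antisym
      (indicator-mono (reaches? j₀ (src j)) (reaches? j₀ (tgt j)) (reaches-step (j , j≢j₀ , inj₁ (refl , refl))))
      (indicator-mono (reaches? j₀ (tgt j)) (reaches? j₀ (src j)) (reaches-step (j , j≢j₀ , inj₂ (refl , refl))))) ,
    indicator-no (reaches? j₀ (src j₀)) (bridge j₀) ,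
    indicator-yes (reaches? j₀ (tgt j₀)) (inj₁ refl)

module _ (B : Fin m → Point n) where

  span-dir-trans : ∀ a b c → InSpan B (dir a b) → InSpan B (dir b c) → InSpan B (dir a c)
  span-dir-trans a b c ab bc = span-resp B (λ i → lemma (e a i) (e b i) (e c i)) (span-+ B ab bc)
    where
    lemma : ∀ x y z → (y - x) + (z - y) ≡ z - x
    lemma = solve-∀ ℚ-ring

  span-dir-self : ∀ a → InSpan B (dir a a)
  span-dir-self a = span-resp B (λ i → sym (dir-self a i)) (span-zero B)

  span-dir-sym : ∀ a b → InSpan B (dir a b) → InSpan B (dir b a)
  span-dir-sym a b ab = span-resp B (λ i → lemma (e a i) (e b i)) (span-* B (- 1ℚ) ab)
    where
    lemma : ∀ x y → (- 1ℚ) * (y - x) ≡ x - y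
    lemma = solve-∀ ℚ-ring

  span-telescope : ∀ N (c : Fin (suc N) → Fin n) →
    (∀ i → InSpan B (dir (c (inject₁ i)) (c (suc i)))) → InSpan B (dir (c zero) (c (fromℕ N)))
  span-telescope zero    c mem = span-dir-self (c zero)
  span-telescope (suc N) c mem =
    span-dir-trans (c zero) (c (suc zero)) (c (fromℕ (suc N))) (mem zero) (span-telescope N (c ∘ suc) (mem ∘ suc))

-- The edge closing the cycle is minus the sum of the others, so it can be dropped from the spanning family.
cycle⇒¬affInd : (src tgt : Fin m → Fin n) (S : Point n → Set) (x : Point n) →
  (∀ y → S y → InSpan (edges src tgt) (λ i → y i - x i)) →
  ∀ k (c : Fin (suc (suc (suc k))) → Fin n) → Injective _≡_ _≡_ c →
  (∀ i → ∃ λ j → Joins src tgt j (c (inject₁ i)) (c (suc i))) →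
  (∃ λ j → Joins src tgt j (c (fromℕ (suc (suc k)))) (c zero)) →
  ¬ HasAffInd S m
cycle⇒¬affInd {suc m} {n} src tgt S x S⊆span k c c-inj links (j₀ , closing) =
  span⇒¬affInd S x B (λ y y∈S → span-trans (edges src tgt) B edge∈ (S⊆span y y∈S))
  where
  B : Fin m → Point n
  B = edges src tgt ∘ punchIn j₀
  other∈ : ∀ j → j ≢ j₀ → InSpan B (edges src tgt j)
  other∈ j j≢j₀ = subst (λ l → InSpan B (edges src tgt l)) (Fin.punchIn-punchOut (j≢j₀ ∘ sym))
    (span-generator B (punchOut (j≢j₀ ∘ sym)))
  joins∈ : ∀ {a b j} → Joins src tgt j a b → j ≢ j₀ → InSpan B (dir a b)
  joins∈ {j = j} (inj₁ (refl , refl)) j≢j₀ = other∈ j j≢j₀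
  joins∈ {j = j} (inj₂ (refl , refl)) j≢j₀ = span-dir-sym B (src j) (tgt j) (other∈ j j≢j₀)
  start≢end : ∀ i → c (inject₁ i) ≢ c (fromℕ (suc (suc k)))
  start≢end i eq = Fin.fromℕ≢inject₁ (sym (c-inj eq))
  -- A cycle on at least three distinct points does not traverse its closing edge a second time in
  -- reverse.
  not-closing : ∀ i → c (inject₁ i) ≡ c zero → c (suc i) ≢ c (fromℕ (suc (suc k)))
  not-closing zero _ eq with c-inj eq
  ... | ()
  not-closing (suc i) eq with c-inj eq
  ... | ()
  distinct : ∀ i → Joins src tgt j₀ (c (inject₁ i)) (c (suc i)) →
             Joins src tgt j₀ (c (fromℕ (suc (suc k)))) (c zero) → ⊥
  distinct i (inj₁ (s , t)) (inj₁ (s′ , t′)) = start≢end i (trans (sym s) s′)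
  distinct i (inj₁ (s , t)) (inj₂ (s′ , t′)) = not-closing i (trans (sym s) s′) (trans (sym t) t′)
  distinct i (inj₂ (s , t)) (inj₁ (s′ , t′)) = not-closing i (trans (sym t) t′) (trans (sym s) s′)
  distinct i (inj₂ (s , t)) (inj₂ (s′ , t′)) = start≢end i (trans (sym t) t′)
  link∈ : ∀ i → InSpan B (dir (c (inject₁ i)) (c (suc i)))
  link∈ i = joins∈ (proj₂ (links i))
    (λ j≡j₀ → distinct i (subst (λ l → Joins src tgt l _ _) j≡j₀ (proj₂ (links i))) closing)
  closing∈ : Joins src tgt j₀ (c (fromℕ (suc (suc k)))) (c zero) → InSpan B (edges src tgt j₀)
  closing∈ (inj₁ (s , t)) = subst₂ (λ a b → InSpan B (dir a b)) (sym s) (sym t)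
    (span-dir-sym B (c zero) (c (fromℕ (suc (suc k)))) (span-telescope B (suc (suc k)) c link∈))
  closing∈ (inj₂ (s , t)) = subst₂ (λ a b → InSpan B (dir a b)) (sym s) (sym t)
    (span-telescope B (suc (suc k)) c link∈)
  edge∈ : ∀ j → InSpan B (edges src tgt j)
  edge∈ j with j Fin.≟ j₀
  ... | yes refl = closing∈ closing
  ... | no j≢j₀  = other∈ j j≢j₀

-- The polytope near the vertex of an acyclic orientation

module Orientation {n : ℕ} (G : List (Subset n)) (h : Fin (length G) → Fin n) (h∈O₀ : InO₀ G h) where

  open Polytope G

  h∈ : IsChoice h
  h∈ = proj₁ h∈O₀

  acyclic : ∀ u → ¬ Path G h u u
  acyclic = proj₂ h∈O₀

  arrow : ∀ {j i} → i ∈ lookup G j → i ≢ h j → Path G h (h j) i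
  arrow i∈ i≢ = [ _ , refl , i∈ , i≢ ]

  path? : ∀ u v → Dec (Path G h u v)
  path? = closure? (λ u v → Fin.any? (λ j → (h j Fin.≟ u) ×-dec (v ∈? lookup G j) ×-dec ¬? (v Fin.≟ u)))

  cover? : ∀ u v → Dec (Cover G h u v)
  cover? u v = path? u v ×-dec ¬? (Fin.any? (λ w → path? u w ×-dec path? w v))

  path-≢ : ∀ {u v} → Path G h u v → u ≢ v
  path-≢ p refl = acyclic _ p

  -- The number of vertices reachable from `a`. It drops along an arrow to `i`, since everything
  -- reachable from `i` is reachable from its head, and `i` in addition.
  height : Point n
  height a = count (path? a)

  height-strict : StrictlyMaximises height h
  height-strict j i i∈ i≢ = <-≤-trans (<-+1 (height i))
    (count-gap (path? i) (path? (h j)) (λ w p → arrow i∈ i≢ ++ p) i (acyclic i) (arrow i∈ i≢))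

  X-vertex : Vertex G (X h)
  X-vertex = strict⇒vertex {height} {h} h∈ height-strict

  cover⇒arrow : ∀ {u v} → Cover G h u v → Arrow G h u v
  cover⇒arrow ([ r ] , _)          = r
  cover⇒arrow (r ∷ p , noBetween) = ⊥-elim (noBetween (_ , [ r ] , p))

  flip : Fin n → Fin n → Selection
  flip u v j with (h j Fin.≟ u) ×-dec (v ∈? lookup G j)
  ... | yes _ = v
  ... | no  _ = h j

  flip-cases : ∀ u v j → (h j ≡ u × v ∈ lookup G j × flip u v j ≡ v) ⊎
                         (¬ (h j ≡ u × v ∈ lookup G j) × flip u v j ≡ h j)
  flip-cases u v j with (h j Fin.≟ u) ×-dec (v ∈? lookup G j)
  ... | yes (eq , v∈) = inj₁ (eq , v∈ , refl)
  ... | no  ¬flip     = inj₂ (¬flip , refl)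

  flip-choice : ∀ u v → IsChoice (flip u v)
  flip-choice u v j with flip-cases u v j
  ... | inj₁ (_ , v∈ , eq) = subst (_∈ lookup G j) (sym eq) v∈
  ... | inj₂ (_ , eq)      = subst (_∈ lookup G j) (sym eq) (h∈ j)

  flip-move : ∀ u v → Move h (flip u v) u v
  flip-move u v j with flip-cases u v j
  ... | inj₁ (h≡u , _ , eq) = inj₂ (h≡u , eq)
  ... | inj₂ (_ , eq)       = inj₁ eq

  module CoverEdge {u v : Fin n} (cover : Cover G h u v) where

    u≢v : u ≢ v
    u≢v = path-≢ (proj₁ cover)

    _≤*_ : Fin n → Fin n → Set
    a ≤* b = a ≡ b ⊎ Path G h a b

    _≤*?_ : ∀ a b → Dec (a ≤* b)
    a ≤*? b = (a Fin.≟ b) ⊎-dec path? a b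

    ≤*-extend : ∀ {a b w} → Path G h a b → b ≤* w → Path G h a w
    ≤*-extend p (inj₁ refl) = p
    ≤*-extend p (inj₂ q)    = p ++ q

    -- The preorder generated by the arrows together with v → u.
    _⊑_ : Fin n → Fin n → Set
    a ⊑ w = a ≤* w ⊎ (a ≤* v × u ≤* w)

    _⊑?_ : ∀ a w → Dec (a ⊑ w)
    a ⊑? w = (a ≤*? w) ⊎-dec ((a ≤*? v) ×-dec (u ≤*? w))

    -- The size of the up-set of `a`. Under `_⊑_` the ends `u` and `v` are equivalent, hence tied.
    c : Point n
    c a = count (a ⊑?_)

    c-tie : c u ≡ c v
    c-tie = ≤-antisym
      (count-mono (u ⊑?_) (v ⊑?_) λ where
        w (inj₁ u≤w)       → inj₂ (inj₁ refl , u≤w)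
        w (inj₂ (_ , u≤w)) → inj₂ (inj₁ refl , u≤w))
      (count-mono (v ⊑?_) (u ⊑?_) λ where
        w (inj₁ v≤w)       → inj₁ (inj₂ (≤*-extend (proj₁ cover) v≤w))
        w (inj₂ (_ , u≤w)) → inj₁ u≤w)

    -- If `b ⊑ a` held along a path from `a` to `b`, there would be a directed cycle, or `u ≤* a`
    -- and `b ≤* v`; the latter puts `a` or `b` strictly between `u` and `v` unless the pair is the
    -- cover itself. So `a` is counted for `a` but not for `b`.
    c-gap : ∀ {a b} → Path G h a b → ¬ (a ≡ u × b ≡ v) → c b + 1ℚ ≤ c a
    c-gap {a} {b} p ≢uv = count-gap (b ⊑?_) (a ⊑?_) up a not-back (inj₁ (inj₁ refl))
      where
      up : ∀ w → b ⊑ w → a ⊑ w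
      up w (inj₁ b≤w)         = inj₁ (inj₂ (≤*-extend p b≤w))
      up w (inj₂ (b≤v , u≤w)) = inj₂ (inj₂ (≤*-extend p b≤v) , u≤w)
      not-back : ¬ (b ⊑ a)
      not-back (inj₁ b≤a)                     = acyclic a (≤*-extend p b≤a)
      not-back (inj₂ (inj₁ refl , inj₁ refl)) = ≢uv (refl , refl)
      not-back (inj₂ (inj₂ b<v , inj₁ refl))  = proj₂ cover (b , p , b<v)
      not-back (inj₂ (b≤v , inj₂ u<a))        = proj₂ cover (a , u<a , ≤*-extend p b≤v)

    c-max : Maximises c h
    c-max j i i∈ with i Fin.≟ h j | (h j Fin.≟ u) ×-dec (i Fin.≟ v)
    ... | yes refl | _                 = ≤-refl
    ... | no _     | yes (refl , refl) = ≤-reflexive (sym c-tie)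
    ... | no i≢    | no ≢uv            = ≤-trans (<⇒≤ (<-+1 (c i))) (c-gap (arrow i∈ i≢) ≢uv)

    neighbour : Selection
    neighbour = flip u v

    c-max-neighbour : Maximises c neighbour
    c-max-neighbour j i i∈ with flip-cases u v j
    ... | inj₁ (h≡u , _ , eq) = ≤-trans (c-max j i i∈) (≤-reflexive (trans (cong c h≡u) (trans c-tie (sym (cong c eq)))))
    ... | inj₂ (_ , eq)       = ≤-trans (c-max j i i∈) (≤-reflexive (sym (cong c eq)))

    -- c has integral gaps, so doubling it leaves room for raising v above u.
    c′ : Point n
    c′ i = (c i + c i) + e v i

    c′-strict : StrictlyMaximises c′ neighbour
    c′-strict j i i∈ i≢ with flip-cases u v j
    ... | inj₁ (h≡u , v∈ , eq) = subst (λ a → c′ i < c′ a) (sym eq)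
      (+-mono-≤-< (+-mono-≤ ci≤cv ci≤cv)
        (subst₂ _<_ (sym (e-diff (λ v≡i → i≢ (trans (sym v≡i) (sym eq))))) (sym (e-same v)) 0<1))
      where
      ci≤cv : c i ≤ c v
      ci≤cv = ≤-trans (c-max j i i∈) (≤-reflexive (trans (cong c h≡u) c-tie))
    ... | inj₂ (¬flip , eq) = subst (λ a → c′ i < c′ a) (sym eq)
      (<-≤-trans (≤-<-trans (+-monoʳ-≤ (c i + c i) (e-≤1 v i)) (<-+1 (c i + c i + 1ℚ)))
        (subst (_≤ c′ (h j)) (lemma (c i)) (+-mono-≤ (+-mono-≤ gap gap) (e-nonneg v (h j)))))
      where
      gap : c i + 1ℚ ≤ c (h j)
      gap = c-gap (arrow i∈ (λ i≡h → i≢ (trans i≡h (sym eq)))) (λ { (h≡u , refl) → ¬flip (h≡u , i∈) })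
      lemma : ∀ x → ((x + 1ℚ) + (x + 1ℚ)) + 0ℚ ≡ ((x + x) + 1ℚ) + 1ℚ
      lemma = solve-∀ ℚ-ring

    j₀ : Fin (length G)
    j₀ = proj₁ (cover⇒arrow cover)

    j₀-moves : neighbour j₀ ≢ h j₀
    j₀-moves eq′ with flip-cases u v j₀
    ... | inj₁ (h≡u , _ , eq) = u≢v (trans (sym h≡u) (trans (sym eq′) eq))
    ... | inj₂ (¬flip , _)    = let _ , h≡u , v∈ , _ = cover⇒arrow cover in ¬flip (h≡u , v∈)

    open Shift h neighbour u v (flip-move u v) public

    edge : Fin 1 → Point n
    edge = dir u v ◂ λ ()

    -- On this face only weights at ties survive, and the only tie of a head with another vertex is
    -- `u` with `v`; so every displacement is a multiple of `dir u v`.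
    face-dim : HasDim (Face G c) 1
    face-dim = (X h ◂ (X neighbour ◂ λ ()) ,
                (λ { zero → X-face ; (suc zero) → neighbour-face }) ,
                linInd⇒affInd (X h) {edge} {X neighbour ◂ λ ()} (λ _ → amount) (λ _ → amount≢0 j₀ j₀-moves)
                  (λ { zero → shift }) (dir-linInd₁ u≢v)) ,
               span⇒¬affInd (Face G c) (X h) edge on-line
      where
      X-face : Face G c (X h)
      X-face = max⇒face {c} {h} h∈ c-max
      neighbour-face : Face G c (X neighbour)
      neighbour-face = max⇒face {c} {neighbour} (flip-choice u v) c-max-neighbour
      on-line : ∀ y → Face G c y → InSpan edge (λ i → y i - X h i)
      on-line y (y∈P , maximal) = displacement-span y∈P h edge term
        where
        term : ∀ j a → proj₁ y∈P j a ≡ 0ℚ ⊎ InSpan edge (dir (h j) a)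
        term j a with a ∈? lookup G j | a Fin.≟ h j | (h j Fin.≟ u) ×-dec (a Fin.≟ v)
        ... | no a∉  | _        | _                 = inj₁ (coeff-outside y∈P h a∉)
        ... | yes _  | yes refl | _                 = inj₂ (span-dir-self edge a)
        ... | yes _  | no _     | yes (refl , refl) = inj₂ (span-generator edge zero)
        ... | yes a∈ | no a≢    | no ≢uv            = inj₁ (coeff-below-max y∈P h {c} c-max (maximal _ (X-inP h∈))
          (<-≤-trans (<-+1 (c a)) (c-gap (arrow a∈ a≢) ≢uv)))

    adjacent : Adjacent G (X h) (X neighbour)
    adjacent = X-vertex , strict⇒vertex {c′} {neighbour} (flip-choice u v) c′-strict ,
      (λ eq → X-moved j₀ j₀-moves (λ i → sym (eq i))) ,
      c , face-dim , max⇒face {c} {h} h∈ c-max , max⇒face {c} {neighbour} (flip-choice u v) c-max-neighbour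

  -- Two different ties of c would give two independent directions, so a one-dimensional face has just one.
  module EdgeCover {h′ : Selection} (h′∈O₀ : InO₀ G h′) {c : Point n}
    (¬aff : ¬ HasAffInd (Face G c) 2) (X∈ : Face G c (X h)) (X′∈ : Face G c (X h′))
    (j₀ : Fin (length G)) (moved : h′ j₀ ≢ h j₀) where

    c-max : Maximises c h
    c-max = face⇒max {c} {h} h∈ X∈

    h′-tie : ∀ j → c (h′ j) ≡ c (h j)
    h′-tie j = ≤-antisym (c-max j _ (proj₁ h′∈O₀ j)) (face⇒max {c} {h′} (proj₁ h′∈O₀) X′∈ j _ (h∈ j))

    Tie : Fin (length G) → Fin n → Set
    Tie j b = b ∈ lookup G j × b ≢ h j × c b ≡ c (h j)

    tie-unique : ∀ {j b j′ b′} → Tie j b → Tie j′ b′ → h j ≡ h j′ × b ≡ b′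
    tie-unique {j} {b} {j′} {b′} (b∈ , b≢ , cb) (b′∈ , b′≢ , cb′) with (h j Fin.≟ h j′) ×-dec (b Fin.≟ b′)
    ... | yes same = same
    ... | no ≢same = ⊥-elim (¬aff (X h ◂ p , p∈ , linInd⇒affInd (X h) {B} {p} t t≢0 shifts
        (dir-linInd₂ (b≢ ∘ sym) (b′≢ ∘ sym) ≢same opposite)))
      where
      module S  = UpdateShift h j b
      module S′ = UpdateShift h j′ b′
      p B : Fin 2 → Point n
      p = X (update h j b) ◂ (X (update h j′ b′) ◂ λ ())
      B = dir (h j) b ◂ (dir (h j′) b′ ◂ λ ())
      t : Fin 2 → ℚ
      t = S.amount ◂ (S′.amount ◂ λ ())
      t≢0 : ∀ i → t i ≢ 0ℚ
      t≢0 zero       = S.amount≢0 j (update-≢ h j b≢)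
      t≢0 (suc zero) = S′.amount≢0 j′ (update-≢ h j′ b′≢)
      shifts : ∀ l i → p l i ≡ X h i + t l * B l i
      shifts zero       = S.shift
      shifts (suc zero) = S′.shift
      p∈ : ∀ l → Face G c ((X h ◂ p) l)
      p∈ zero             = X∈
      p∈ (suc zero)       = max⇒face {c} {update h j b} (update-choice h∈ b∈) (update-max {c} {h} c-max cb)
      p∈ (suc (suc zero)) = max⇒face {c} {update h j′ b′} (update-choice h∈ b′∈) (update-max {c} {h} c-max cb′)
      -- Opposite directions would be dependent too, but they come from two arrows forming a
      -- directed cycle.
      opposite : ¬ (h j ≡ b′ × b ≡ h j′)
      opposite (eq , eq′) = acyclic (h j)
        (subst (Path G h (h j)) eq′ (arrow b∈ b≢) ++ subst (Path G h (h j′)) (sym eq) (arrow b′∈ b′≢))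

    u v : Fin n
    u = h j₀
    v = h′ j₀

    moved-tie : ∀ {j} → h′ j ≢ h j → Tie j (h′ j)
    moved-tie {j} ≢h = proj₁ h′∈O₀ j , ≢h , h′-tie j

    first-arrow : ∀ {a w b} → Path G h a w → Path G h w b → ∃ λ x → Arrow G h a x × Path G h x b
    first-arrow [ r ]   q = _ , r , q
    first-arrow (r ∷ p) q = _ , r , p ++ q

    -- On a detour the first vertex `x` after `u` has its value squeezed between the equal `c u` and
    -- `c v`. It is then a tie, hence `v` itself, and the rest of the detour is a cycle at `v`.
    cover : Cover G h u v
    cover = arrow (proj₁ h′∈O₀ j₀) moved , λ (w , p , q) → no-detour (first-arrow p q)
      where
      no-detour : ¬ (∃ λ x → Arrow G h u x × Path G h x v)
      no-detour (x , (j , h≡u , x∈ , x≢u) , q) = acyclic v (subst (λ a → Path G h a v) x≡v q)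
        where
        cx : c x ≡ c (h j)
        cx = ≤-antisym (c-max j x x∈) (≤-trans (≤-reflexive (trans (cong c h≡u) (sym (h′-tie j₀))))
          (path-weakly-decreases c h c-max q))
        x≡v : x ≡ v
        x≡v = proj₂ (tie-unique (x∈ , (λ eq → x≢u (trans eq h≡u)) , cx) (moved-tie moved))

    -- A hyperedge with head `u` that contains `v` cannot stay put: under `h′` it would give an
    -- arrow from `u` to `v`, while `j₀` gives one back.
    h′≡flip : ∀ j → h′ j ≡ flip u v j
    h′≡flip j with flip-cases u v j | h′ j Fin.≟ h j
    ... | inj₁ (h≡u , v∈ , eq) | yes same = ⊥-elim (proj₂ h′∈O₀ u
      ((j , trans same h≡u , v∈ , moved) ∷ [ j₀ , refl , h∈ j₀ , moved ∘ sym ]))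
    ... | inj₁ (h≡u , v∈ , eq) | no ≢h    = trans (proj₂ (tie-unique (moved-tie ≢h) (moved-tie moved))) (sym eq)
    ... | inj₂ (¬flip , eq)    | yes same = trans same (sym eq)
    ... | inj₂ (¬flip , eq)    | no ≢h    =
      let h≡u , h′≡v = tie-unique (moved-tie ≢h) (moved-tie moved)
      in ⊥-elim (¬flip (h≡u , subst (_∈ lookup G j) h′≡v (proj₁ h′∈O₀ j)))

  module _ (nonempty : ∀ j → Nonempty (lookup G j)) where

    adjacent⇒cover : ∀ {w} → Adjacent G (X h) w → ∃ λ u → ∃ λ v → Cover G h u v × w ≈ₚ X (flip u v)
    adjacent⇒cover {w} (_ , w-vertex , X≉w , c , (_ , ¬aff) , X∈ , w∈) =
      from-selection (proj₁ other) (proj₁ (proj₂ other)) (proj₂ (proj₂ other))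
      where
      other = vertex⇒O₀ nonempty w-vertex
      from-selection : ∀ h′ → InO₀ G h′ → w ≈ₚ X h′ →
                       ∃ λ u → ∃ λ v → Cover G h u v × w ≈ₚ X (flip u v)
      from-selection h′ h′∈O₀ w≈X′ with Fin.any? (λ j → ¬? (h′ j Fin.≟ h j))
      ... | yes (j₀ , moved) = E.u , E.v , E.cover , λ i → trans (w≈X′ i) (X-cong {h′} {flip E.u E.v} E.h′≡flip i)
        where
        module E = EdgeCover h′∈O₀ {c} ¬aff X∈ (Face-resp c w≈X′ w∈) j₀ moved
      ... | no unmoved = ⊥-elim (X≉w λ i → sym (trans (w≈X′ i)
              (X-cong {h′} {h} (λ j → decidable-stable (h′ j Fin.≟ h j) (λ ≢h → unmoved (j , ≢h))) i)))

  -- Covers as index set of the edges at X h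

  coverPair? : (p : Fin n × Fin n) → Dec (Cover G h (proj₁ p) (proj₂ p))
  coverPair? (u , v) = cover? u v

  pairs : List (Fin n × Fin n)
  pairs = cartesianProduct (allFin n) (allFin n)

  covers : List (Fin n × Fin n)
  covers = filter coverPair? pairs

  src tgt : Fin (length covers) → Fin n
  src k = proj₁ (lookup covers k)
  tgt k = proj₂ (lookup covers k)

  isCover : ∀ k → Cover G h (src k) (tgt k)
  isCover k = proj₂ (∈-filter⁻ coverPair? {xs = pairs} (∈-lookup {xs = covers} k))

  cover-index : ∀ {u v} → Cover G h u v → ∃ λ k → src k ≡ u × tgt k ≡ v
  cover-index {u} {v} cover = index mem , cong proj₁ (sym (lookup-index mem)) , cong proj₂ (sym (lookup-index mem))
    where
    mem = ∈-filter⁺ coverPair? {xs = pairs} (∈-cartesianProduct⁺ (∈-allFin u) (∈-allFin v)) cover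

  cover-unique : ∀ {k l} → src k ≡ src l → tgt k ≡ tgt l → k ≡ l
  cover-unique src≡ tgt≡ = lookup-injective
    (filter⁺ coverPair? (cartesianProduct⁺ (allFin⁺ n) (allFin⁺ n))) (cong₂ _,_ src≡ tgt≡)

  -- A spanning family of the displacements; it is independent only under the forest condition.
  basis : Fin (length covers) → Point n
  basis = edges src tgt

  path-span : ∀ {a b} → TransClosure (Cover G h) a b → InSpan basis (dir a b)
  path-span {a} {b} [ cover ] = edge-span (cover-index cover)
    where
    edge-span : (∃ λ k → src k ≡ a × tgt k ≡ b) → InSpan basis (dir a b)
    edge-span (k , src≡ , tgt≡) = subst₂ (λ x y → InSpan basis (dir x y)) src≡ tgt≡ (span-generator basis k)
  path-span {a} {b} (_∷_ {y = w} cover p) =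
    span-dir-trans basis a w b (path-span [ cover ]) (path-span p)

  P-span : ∀ y → InP G y → InSpan basis (λ i → y i - X h i)
  P-span y y∈P = displacement-span y∈P h basis term
    where
    term : ∀ j a → proj₁ y∈P j a ≡ 0ℚ ⊎ InSpan basis (dir (h j) a)
    term j a with a ∈? lookup G j | a Fin.≟ h j
    ... | no a∉  | _        = inj₁ (coeff-outside y∈P h a∉)
    ... | yes _  | yes refl = inj₂ (span-dir-self basis a)
    ... | yes a∈ | no a≢    = inj₂ (path-span (refine-to-covers (Path G h) _++_ acyclic path? (allFin n)
      (λ w _ _ → ∈-allFin w) (arrow a∈ a≢)))

  neighbours : Fin (length covers) → Point n
  neighbours k = X (flip (src k) (tgt k))

  module Neighbour (k : Fin (length covers)) = CoverEdge (isCover k)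

  length-of : Fin (length covers) → ℚ
  length-of k = Neighbour.amount k

  length-of≢0 : ∀ k → length-of k ≢ 0ℚ
  length-of≢0 k = Neighbour.amount≢0 k (Neighbour.j₀ k) (Neighbour.j₀-moves k)

  -- Equal neighbours would make two cover directions proportional. Two distinct covers are
  -- independent even when the whole family is not.
  neighbours-injective : ∀ k l → neighbours k ≈ₚ neighbours l → k ≡ l
  neighbours-injective k l eq with (src k Fin.≟ src l) ×-dec (tgt k Fin.≟ tgt l)
  ... | yes (src≡ , tgt≡) = cover-unique src≡ tgt≡
  ... | no ≢same = ⊥-elim (length-of≢0 k (dir-linInd₂ (path-≢ (proj₁ (isCover k))) (path-≢ (proj₁ (isCover l)))
      ≢same opposite (length-of k ◂ (- length-of l ◂ λ ())) relation zero))
    where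
    opposite : ¬ (src k ≡ tgt l × tgt k ≡ src l)
    opposite (eq , eq′) = acyclic (src k) (subst (Path G h (src k)) eq′ (proj₁ (isCover k))
      ++ subst (Path G h (src l)) (sym eq) (proj₁ (isCover l)))
    relation : ∀ i → length-of k * basis k i + (- length-of l * basis l i + 0ℚ) ≡ 0ℚ
    relation i = begin
      length-of k * basis k i + (- length-of l * basis l i + 0ℚ)
        ≡⟨ lemma (X h i) (length-of k) (basis k i) (length-of l) (basis l i) ⟩
      (X h i + length-of k * basis k i) - (X h i + length-of l * basis l i)
        ≡⟨ cong₂ _-_ (Neighbour.shift k i) (Neighbour.shift l i) ⟨
      neighbours k i - neighbours l i
        ≡⟨ cong (_- neighbours l i) (eq i) ⟩
      neighbours l i - neighbours l i
        ≡⟨ +-inverseʳ (neighbours l i) ⟩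
      0ℚ ∎
      where
      open ≡-Reasoning
      lemma : ∀ x t d s f → t * d + (- s * f + 0ℚ) ≡ (x + t * d) - (x + s * f)
      lemma = solve-∀ ℚ-ring

  degree : (∀ j → Nonempty (lookup G j)) → DegreeIs G (X h) (length covers)
  degree nonempty = neighbours , (λ k → Neighbour.adjacent k) , neighbours-injective , λ w adj → complete (adjacent⇒cover nonempty adj)
    where
    complete : ∀ {w} → (∃ λ u → ∃ λ v → Cover G h u v × w ≈ₚ X (flip u v)) → ∃ λ k → w ≈ₚ neighbours k
    complete {w} (u , v , cover , w≈) = reindex (cover-index cover)
      where
      reindex : (∃ λ k → src k ≡ u × tgt k ≡ v) → ∃ λ k → w ≈ₚ neighbours k
      reindex (k , src≡ , tgt≡) = k , subst₂ (λ a b → w ≈ₚ X (flip a b)) (sym src≡) (sym tgt≡) w≈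

  P-dim : LinInd basis → HasDim (InP G) (length covers)
  P-dim ind = (X h ◂ neighbours ,
               (λ { zero → X-inP h∈ ; (suc k) → X-inP (flip-choice (src k) (tgt k)) }) ,
               linInd⇒affInd (X h) {basis} {neighbours} length-of length-of≢0 (λ k → Neighbour.shift k) ind) ,
              span⇒¬affInd (InP G) (X h) basis P-span

  linked⇒hasseAdj : ∀ {k a b} → Joins src tgt k a b → HasseAdj G h a b
  linked⇒hasseAdj {k} (inj₁ (refl , refl)) = inj₁ (isCover k)
  linked⇒hasseAdj {k} (inj₂ (refl , refl)) = inj₂ (isCover k)

  hasseAdj⇒linked : ∀ {a b} → HasseAdj G h a b → ∃ λ k → Joins src tgt k a b
  hasseAdj⇒linked (inj₁ cover) = let k , eqs = cover-index cover in k , inj₁ eqs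
  hasseAdj⇒linked (inj₂ cover) = let k , eqs = cover-index cover in k , inj₂ eqs

  -- A walk from `tgt k` back to `src k` avoiding `k`, once made simple, is closed by `k` to a cycle
  -- of the Hasse diagram.
  forest⇒linInd : IsForest G h → LinInd basis
  forest⇒linInd forest = bridges⇒linInd src tgt bridge
    where
    no-return : ∀ k {a b xs} → Walk (LinkedAvoiding src tgt k) a b xs → Unique xs →
                tgt k ≡ a → src k ≡ b → ⊥
    no-return k {xs = x ∷ []} walk uniq tgt≡ src≡ = path-≢ (proj₁ (isCover k))
      (trans src≡ (trans (sym (walk-last _ walk)) (trans (walk-first _ walk) (sym tgt≡))))
    -- `IsForest` speaks of cycles of length at least three, so an edge parallel to `k` is excluded
    -- separately: reversed, it breaks acyclicity; in the same direction, it is `k`.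
    no-return k {xs = x ∷ y ∷ []} walk uniq tgt≡ src≡ = parallel (walk-step _ walk zero)
      where
      x≡tgt : x ≡ tgt k
      x≡tgt = trans (walk-first _ walk) (sym tgt≡)
      y≡src : y ≡ src k
      y≡src = trans (walk-last _ walk) (sym src≡)
      parallel : ¬ LinkedAvoiding src tgt k x y
      parallel (l , l≢k , inj₁ (srcl≡x , tgtl≡y)) = acyclic (src k) (proj₁ (isCover k) ++
        subst₂ (Path G h) (trans srcl≡x x≡tgt) (trans tgtl≡y y≡src) (proj₁ (isCover l)))
      parallel (l , l≢k , inj₂ (srcl≡y , tgtl≡x)) =
        l≢k (cover-unique (trans srcl≡y y≡src) (trans tgtl≡x x≡tgt))
    no-return k {xs = x ∷ y ∷ z ∷ zs} walk uniq tgt≡ src≡ =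
      forest (length zs) (lookup (x ∷ y ∷ z ∷ zs)) (lookup-injective uniq)
        (λ i → linked⇒hasseAdj (proj₂ (proj₂ (walk-step _ walk i))))
        (inj₁ (subst₂ (Cover G h) (trans src≡ (sym (walk-last _ walk)))
                                  (trans tgt≡ (sym (walk-first _ walk))) (isCover k)))
    bridge : ∀ k → ¬ Reaches src tgt k (src k)
    bridge k (inj₁ tgt≡src) = path-≢ (proj₁ (isCover k)) (sym tgt≡src)
    bridge k (inj₂ path) = let _ , walk , uniq = simple-walk (LinkedAvoiding src tgt k) Fin._≟_ path
                           in no-return k walk uniq refl refl

  dim⇒forest : HasDim (InP G) (length covers) → IsForest G h
  dim⇒forest (aff , _) k c c-inj links closing =
    cycle⇒¬affInd src tgt (InP G) (X h) P-span k c c-inj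
      (λ i → hasseAdj⇒linked (links i)) (hasseAdj⇒linked closing) aff

-- Comparing degree and dimension

degree-≤ : ∀ (G : List (Subset n)) {v k m} → DegreeIs G v k → DegreeIs G v m → k ℕ.≤ m
degree-≤ G {v} {k} {m} (ws , adj , ws-inj , _) (ws′ , _ , _ , complete) = Fin.injective⇒≤ {f = f} f-inj
  where
  f : Fin k → Fin m
  f j = proj₁ (complete (ws j) (adj j))
  f-spec : ∀ j → ws j ≈ₚ ws′ (f j)
  f-spec j = proj₂ (complete (ws j) (adj j))
  f-inj : Injective _≡_ _≡_ f
  f-inj {i} {j} eq = ws-inj i j λ l → trans (f-spec i l) (trans (cong (λ a → ws′ a l) eq) (sym (f-spec j l)))

degree-resp : ∀ (G : List (Subset n)) {x y d} → x ≈ₚ y → DegreeIs G x d → DegreeIs G y d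
degree-resp G x≈y (ws , adj , inj , complete) =
  ws , (λ j → Polytope.Adjacent-resp G x≈y (adj j)) , inj ,
  λ w adj-w → complete w (Polytope.Adjacent-resp G (λ i → sym (x≈y i)) adj-w)

-- A dimension is available only under double negation, which suffices because `IsForest` ends in
-- `⊥`. Simplicity then equates it with the number of covers, and a cycle contradicts that.
simple⇒forests : ∀ (G : List (Subset n)) → (∀ j → Nonempty (lookup G j)) → IsSimple G →
                 ∀ h → InO₀ G h → IsForest G h
simple⇒forests G nonempty simple h h∈O₀ k c c-inj links closing =
  ¬¬HasDim (InP G) (X h) (X-inP h∈) (suc (length covers)) (span⇒¬affInd (InP G) (X h) basis P-span) has-dim
  where
  open Polytope G
  open Orientation G h h∈O₀
  has-dim : ¬ (∃ λ d → HasDim (InP G) d)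
  has-dim (d , dim) = dim⇒forest (subst (HasDim (InP G)) d≡covers dim) k c c-inj links closing
    where
    simple-degree : DegreeIs G (X h) d
    simple-degree = simple d dim (X h) X-vertex
    d≡covers : d ≡ length covers
    d≡covers = ℕ.≤-antisym (degree-≤ G simple-degree (degree nonempty)) (degree-≤ G (degree nonempty) simple-degree)

forests⇒simple : ∀ (G : List (Subset n)) → (∀ j → Nonempty (lookup G j)) →
                 (∀ h → InO₀ G h → IsForest G h) → IsSimple G
forests⇒simple G nonempty forest d dim v vertex =
  degree-at (proj₁ selection) (proj₁ (proj₂ selection)) (proj₂ (proj₂ selection))
  where
  open Polytope G
  selection = vertex⇒O₀ nonempty vertex
  degree-at : ∀ h → InO₀ G h → v ≈ₚ X h → DegreeIs G v d
  degree-at h h∈O₀ v≈X = degree-resp G (λ i → sym (v≈X i)) (subst (DegreeIs G (X h))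
    (HasDim-unique (InP G) (P-dim (forest⇒linInd (forest h h∈O₀))) dim) (degree nonempty))
    where open Orientation G h h∈O₀

theorem3p2 : (n : ℕ) (G : List (Subset n)) → IsHypergraph n G →
    IsSimple G ⇔ (∀ (h : Fin (length G) → Fin n) → InO₀ G h → IsForest G h)
theorem3p2 n G (_ , sizes) = mk⇔ (simple⇒forests G nonempty) (forests⇒simple G nonempty)
  where
  nonempty : ∀ j → Nonempty (lookup G j)
  nonempty j = hyperedge-nonempty (All.lookup sizes (∈-lookup {xs = G} j))
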